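{- Let $A,B,C,D\in\Pi^+$ be arbitrary predicates. **(I)** The following predicates are 1-provable: (1) $\mathbf t$; (2) $A\lor\neg A$; (3) $A\lor{\sim}A$. **(II)** The following predicates are 2-provable: (4) $A\to A$; (5) $((A\to A)\to B)\to B$; (6) $A\lor A\to A$; (7) $A\to A\lor B$; (8) $B\to A\lor B$; (9) $A\lor B\to B\lor A$; (10) $A\to A\land A$; (11) $A\land B\to A$; (12) $A\land B\to B$; (13) $A\land B\to B\land A$; (14) $(A\lor B)\lor C\to A\lor(B\lor C)$; (15) $(A\land B)\land C\to A\land(B\land C)$; (16) $(A\lor B)\land C\to(A\land C)\lor(B\land C)$; (17) $(A\land B)\lor C\to(A\lor C)\land(B\lor C)$; (18) ${\sim}{\sim}A\to A$; (19) $A\to{\sim}{\sim}A$; (20) ${\sim}(A\lor B)\to{\sim}A\land{\sim}B$; (21) ${\sim}(A\land B)\to{\sim}A\lor{\sim}B$; (22) ${\sim}A\land{\sim}B\to{\sim}(A\lor B)$; (23) ${\sim}A\lor{\sim}B\to{\sim}(A\land B)$; (24) $\neg\neg A\to A$; (25) $A\to\neg\neg A$; (26) $\neg(A\lor B)\to\neg A\land\neg B$; (27) $\neg(A\land B)\to\neg A\lor\neg B$; (28) $\neg A\land\neg B\to\neg(A\lor B)$; (29) $\neg A\lor\neg B\to\neg(A\land B)$; (30) $A\to B\lor\neg B$; (31) $\neg A\land A\to B$. **(III)** The following predicates are 3-provable: (32) $(A\to B)\land(A\to C)\to(A\to B\land C)$; (33) $(A\to C)\land(B\to C)\to(A\lor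 B\to C)$; (34) $(A\to B)\land(C\to D)\to(A\land C\to B\land D)$; (35) $(A\to B)\land(C\to D)\to(A\lor C\to B\lor D)$; (36) $(A\to B)\lor(C\to D)\to(A\land C\to B\lor D)$; (37) $A\circ B\to{\sim}(A\to{\sim}B)$; (38) ${\sim}(A\to{\sim}B)\to A\circ B$; (39) $(A\to B)\circ A\to B$; (40) $A\to(B\to A\circ B)$; (41) $A\to((B\to{\sim}A)\to{\sim}B)$; (42) $A\circ B\land C\to A\circ(B\land{\sim}D)\lor(A\land C\circ D)\circ B$; (43) $A\circ B\land C\to(A\land{\sim}D)\circ B\lor A\circ(B\land D\circ C)$; (44) $A\circ B\land C\to(A\land C\circ B^*)\circ(B\land A^*\circ C)$; (45) $\mathbf t\circ A\to A$; (46) $A\circ\mathbf t\to A$; (47) $A\to A\circ\mathbf t^*$; (48) $\mathbf t\to\mathbf t^*$; (49) $\mathbf t^*\to\mathbf t$; (50) $\mathbf t\land{\sim}\mathbf t\to A$. **(IV)** The following rules are 1-provable: (51) $A,B\vdash A\land B$; (52) $A\to B,A\vdash B$; (53) $A\lor B,{\sim}A\vdash B$; (54) $A\vdash A^*$. **(V)** The following rules are 2-provable: (55) $A\to B,B\to C\vdash A\to C$; (56) $A\to B\vdash{\sim}B\to{\sim}A$; (57) $A\to{\sim}B\vdash B\to{\sim}A$; (58) $A\land B\to C,\ B\to C\lor A\vdash B\to C$; (59) $A\vdash(A\to B)\to B$; (60) $A\land B\to\neg C\vdash A\land C\to\neg B$; (61) $B\land\neg C\to A\land\neg A\vdash B\to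 C$; (62) $B\land C^*\to A\land\neg A\vdash B\to{\sim}C$. **(VI)** The following rules are 3-provable: (63) $A\to B\vdash(B\to C)\to(A\to C)$; (64) $A\to B\vdash(C\to A)\to(C\to B)$; (65) $A\to B,C\to D\vdash(B\to C)\to(A\to D)$; (66) $A\to B,C\to D\vdash A\circ C\to B\circ D$; (67) $A\to(B\to C)\vdash B\to({\sim}C\to{\sim}A)$. **(VII)** The following predicates are 4-provable: (68) $(A\to B)\to((C\to A)\to(C\to B))$; (69) $(A\to(B\to C))\to(A\circ B\to C)$; (70) $(A\circ B\to C)\to(A\to(B\to C))$; (71) $(A\to B)\to(A\circ C\to B\circ C)$; (72) $(A\circ B)\circ C\to A\circ(B\circ C)$; (73) $A\circ(B\circ C)\to(A\circ B)\circ C$. **(VIII)** The following are 3-provable from density: (74) $(A\to{\sim}A)\to{\sim}A$; (75) $A\land B\to A\circ B$; (76) $(A\to B)\to{\sim}A\lor B$. **(IX)** The following are 4-provable from density: (77) $(A\to(A\to B))\to(A\to B)$; (78) $(A\to(B\to C))\to(A\land B\to C)$. **(X)** The following are 3-provable from commutativity: (79) $A\to((A\to B)\to B)$; (80) $(A\to{\sim}B)\to(B\to{\sim}A)$. **(XI)** The following are 4-provable from commutativity: (81) $(A\to(B\to C))\to(B\to(A\to C))$; (82) $(A\to B)\to((B\to C)\to(A\to C))$. **(XII)** The following is 4-provable from density and commutativity: (83) $(A\to(B\to C))\to((A\to B)\to(A\to C))$. **(XIII)** The following is 2-provable from symmetry: (84) $A\land{\sim}A\to B$. **(XIV)** The following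 is 3-provable from symmetry: (85) $A\circ B\to B\circ A$. **(XV)** $\mathsf{CT}_3$ contains the predicates (1)–(50); $\mathsf{CT}_4$ contains the predicates (1)–(50) and (68)–(73); $\mathsf{TR}$ contains the predicates (1)–(50), (68)–(73) and (79)–(83); and each of $\mathsf{CT}_3$, $\mathsf{CT}_4$, $\mathsf{TR}$ has all the rules (51)–(67) (it is closed under them).
   Context: **Predicates.** $\Pi$ is a countably infinite set of binary relation symbols containing the equality symbol $1'$; members of $\Pi$ other than $1'$ are propositional variables. $\Pi^+$ (predicates) is the absolutely free closure of $\Pi$ under the formal operators $A+B$, $\overline A$, $A;B$, $A^\smile$. Abbreviations: $A\lor B=A+B$, $A\land B=A\cdot B=\overline{\overline A+\overline B}$, $\neg A=\overline A$, ${\sim}A=\overline{A^\smile}$, $A\to B=\overline{A^\smile;\overline B}$, $A\circ B=B;A$, $A^*=A^\smile$, $\mathbf t=1'$. Unary operators bind tightest, then $;$, $\circ$, $\land$, $+$, $\lor$, $\to$ in that order. An equation is a formal expression $A\doteq B$; $A\le B$ denotes $A+B\doteq B$. $\Xi^d=\{A\le A;A:A\in\Pi^+\}$ (density), $\Xi^c=\{A;B\doteq B;A:A,B\in\Pi^+\}$ (commutativity), $\Xi^s=\{A\doteq A^\smile:A\in\Pi^+\}$ (symmetry). **Sequent calculus** ($1\le n<\omega$). Let $\Upsilon_n=\{v_i:i<n\}$. An $n$-sequent $\Gamma\,|\,\Delta$ is a pair of subsets of $\{xAy:x,y\in\Upsilon_n,A\in\Pi^+\}$. It is an axiom if $\Gamma\cap\Delta\ne\emptyset$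 or $x1'x\in\Delta$ for some $x$. Rules (premises $\leadsto$ conclusion): Cut: $\Gamma|\Delta,xAy$ and $xAy,\Gamma'|\Delta'\leadsto\Gamma,\Gamma'|\Delta,\Delta'$. Equality: $xAy,\Gamma|\Delta\leadsto xAz,z1'y,\Gamma|\Delta$. Sum: $xAy,\Gamma|\Delta$ and $xBy,\Gamma'|\Delta'\leadsto x(A+B)y,\Gamma,\Gamma'|\Delta,\Delta'$; $\Gamma|\Delta,xAy,xBy\leadsto\Gamma|\Delta,x(A+B)y$. Complement: $\Gamma|\Delta,xAy\leadsto x\overline Ay,\Gamma|\Delta$; $xAy,\Gamma|\Delta\leadsto\Gamma|\Delta,x\overline Ay$. Relative product: $xAy,yBz,\Gamma|\Delta\leadsto x(A;B)z,\Gamma|\Delta$ provided $y\ne x,z$ and $y$ occurs in no formula of $\Gamma\cup\Delta$; $\Gamma|\Delta,xAy$ and $\Gamma'|\Delta',yBz\leadsto\Gamma,\Gamma'|\Delta,\Delta',x(A;B)z$. Converse: $xAy,\Gamma|\Delta\leadsto yA^\smile x,\Gamma|\Delta$; $\Gamma|\Delta,xAy\leadsto\Gamma|\Delta,yA^\smile x$. (The evident rules for $\cdot$ are derivable.) A sequent is $n$-provable from a set $\Theta$ of $n$-sequents if it lies in every set of $n$-sequents containing $\Theta$ and the axioms and closed under the rules. The $n$-sequents corresponding to a set $\Psi$ of equations are all $v_iAv_j,\Gamma|v_iBv_j,\Delta$ and $v_iBv_j,\Gamma|v_iAv_j,\Delta$ with $i,j<n$ and $A\doteq B$ in $\Psi$.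 A predicate $A$ is $n$-provable if the sequent $\;|\;v_0Av_0$ is $n$-provable (from $\emptyset$); it is $n$-provable from density, commutativity or symmetry if $\;|\;v_0Av_0$ is $n$-provable from the $n$-sequents corresponding to $\Xi^d$, $\Xi^c$ or $\Xi^s$ respectively (from the union, when several are named). A rule $A\vdash B$ is $n$-provable if every proof of $\;|\;v_0Av_0$ can be extended, by $n$-sequents obtained via the axioms and rules of the $n$-variable calculus, to a proof of $\;|\;v_0Bv_0$; similarly a rule $A,B\vdash C$ is $n$-provable if every proof containing $\;|\;v_0Av_0$ and $\;|\;v_0Bv_0$ can be so extended to a proof of $\;|\;v_0Cv_0$. **Logics.** $\mathsf{CT}_3=\{A\in\Pi^+:\ \vdash_s^+1'\le A\}$, $\mathsf{CT}_4=\{A\in\Pi^+:\ \vdash_4^+1'\le A\}$, $\mathsf{TR}=\{A\in\Pi^+:\Xi^d\cup\Xi^c\vdash_4^+1'\le A\}$, where $\vdash_s^+$ (for $n=3$) and $\vdash_4^+$ (for $n=4$) are the following. $\Phi_n^+$ is the set of formulas built from $xAy$ ($x,y\in\Upsilon_n$, $A\in\Pi^+$) and equations (no free variables) by $\Rightarrow,\neg,\forall x$ with $x\in\Upsilon_n$ ($\lor,\land,\Leftrightarrow,\exists$ the usual abbreviations). $[\varphi]$ is the universal closure; $S_{xy}\varphi$ interchanges $x$ and $y$ everywhere in $\varphi$ (including in quantifiers). Axioms, for $\varphi,\psi,\xi\in\Phi_n^+$, $x,y\in\Upsilon_n$, $A,B\in\Pi^+$: $[(\varphi\Rightarrow\psi)\Rightarrow((\psi\Rightarrow\xi)\Rightarrow(\varphi\Rightarrow\xi))]$;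 $[(\neg\varphi\Rightarrow\varphi)\Rightarrow\varphi]$; $[\varphi\Rightarrow(\neg\varphi\Rightarrow\psi)]$; $[\forall x\forall y\varphi\Rightarrow\forall y\forall x\varphi]$; $[\forall x(\varphi\Rightarrow\psi)\Rightarrow(\forall x\varphi\Rightarrow\forall x\psi)]$; $[\forall x\varphi\Rightarrow\varphi]$; $[\varphi\Rightarrow\forall x\varphi]$ if $x$ is not free in $\varphi$; $[\exists x(x1'y)]$ if $x\ne y$; $[x1'y\Rightarrow(\varphi\Rightarrow S_{xy}\varphi)]$; $[v_0(A+B)v_1\Leftrightarrow v_0Av_1\lor v_0Bv_1]$; $[v_0\overline Av_1\Leftrightarrow\neg v_0Av_1]$; $[v_0(A;B)v_1\Leftrightarrow\exists v_2(v_0Av_2\land v_2Bv_1)]$; $[v_0A^\smile v_1\Leftrightarrow v_1Av_0]$; $A\doteq B\Leftrightarrow[v_0Av_1\Leftrightarrow v_0Bv_1]$. Provability from $\Psi$ means membership in every set containing $\Psi$ and the axioms and closed under modus ponens. -}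

module Defs where

open import Level using (Level; 0ℓ; _⊔_) renaming (suc to lsuc)
open import Data.Empty using (⊥)
open import Data.Fin using (Fin; zero; suc)
import Data.Fin.Properties as Fin
open import Data.Fin.Permutation.Components using (transpose)
open import Data.List using (List; []; _∷_; foldr; filter; allFin)
open import Data.List.Relation.Unary.All using (All)
open import Data.List.Relation.Unary.Any using (Any)
open import Data.Nat as ℕ using (ℕ; suc; NonZero)
open import Data.Product using (∃; _×_)
open import Data.Sum using (_⊎_)
open import Relation.Binary.PropositionalEquality using (_≡_; _≢_)
import Relation.Nullary as Nullary
open import Relation.Nullary using (Dec; no)
open import Relation.Nullary.Decidable using (¬?; _×-dec_; _⊎-dec_)
open import Relation.Unary using (Pred; _∈_; _∪_; _≐_; _≬_; ∅; ｛_｝)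

private variable
  ℓ : Level
  n : ℕ

------------------------------------------------------------------------
-- Predicates

infixr 30 ¬_ ∼_
infixl 30 _⁻ _˘ _*
infixl 29 _⨾_
infixl 28 _∘_
infixl 27 _∧_
infixl 26 _+_
infixl 25 _∨_
infixr 24 _⟶_
infix  21 _≃_ _≤_

data Predicate : Set where
  1′  : Predicate
  var : ℕ → Predicate
  _+_ : Predicate → Predicate → Predicate
  _⁻  : Predicate → Predicate
  _⨾_ : Predicate → Predicate → Predicate
  _˘  : Predicate → Predicate

_∨_ _∧_ _⟶_ _∘_ : Predicate → Predicate → Predicate
A ∨ B = A + B
A ∧ B = (A ⁻ + B ⁻) ⁻
A ⟶ B = (A ˘ ⨾ B ⁻) ⁻
A ∘ B = B ⨾ A

¬_ ∼_ _* : Predicate → Predicate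
¬ A = A ⁻
∼ A = (A ˘) ⁻
A * = A ˘

𝐭 : Predicate
𝐭 = 1′

data Equation : Set where
  _≃_ : Predicate → Predicate → Equation

_≤_ : Predicate → Predicate → Equation
A ≤ B = A + B ≃ B

data Density : Pred Equation 0ℓ where
  density : ∀ A → Density (A ≤ A ⨾ A)

data Commutativity : Pred Equation 0ℓ where
  commutativity : ∀ A B → Commutativity (A ⨾ B ≃ B ⨾ A)

data Symmetry : Pred Equation 0ℓ where
  symmetry : ∀ A → Symmetry (A ≃ A ˘)

------------------------------------------------------------------------
-- Sequents

infix 8 _⟨_⟩_
infix 5 _∣_
infix 4 _≈_

-- x ⟨ A ⟩ y is the atomic formula xAy; the variable vᵢ is i : Fin n.
record Atom (n : ℕ) : Set where
  constructor _⟨_⟩_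
  field
    left      : Fin n
    predicate : Predicate
    right     : Fin n

open Atom

record Sequent (n : ℕ) : Set₁ where
  constructor _∣_
  field
    antecedent : Pred (Atom n) 0ℓ
    succedent  : Pred (Atom n) 0ℓ

_≈_ : Sequent n → Sequent n → Set
(Γ ∣ Δ) ≈ (Γ′ ∣ Δ′) = (Γ ≐ Γ′) × (Δ ≐ Δ′)

data Axiom {n : ℕ} : Pred (Sequent n) (lsuc 0ℓ) where
  common    : ∀ {Γ Δ} → Γ ≬ Δ → Axiom (Γ ∣ Δ)
  reflexive : ∀ {Γ Δ} x → x ⟨ 1′ ⟩ x ∈ Δ → Axiom (Γ ∣ Δ)

_NotIn_ : Fin n → Pred (Atom n) 0ℓ → Set
y NotIn Γ = ∀ φ → φ ∈ Γ → y ≢ left φ × y ≢ right φ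

-- Rule ps s: the sequent s follows from the premises ps in one step.
data Rule {n : ℕ} : List (Sequent n) → Sequent n → Set₁ where
  -- The two sides of a sequent are sets, so extensionally equal sequents
  -- are the same sequent.
  ext : ∀ {s s′} → s ≈ s′ → Rule (s ∷ []) s′

  cut : ∀ {Γ Γ′ Δ Δ′ x A y} →
    Rule ((Γ ∣ Δ ∪ ｛ x ⟨ A ⟩ y ｝) ∷ (｛ x ⟨ A ⟩ y ｝ ∪ Γ′ ∣ Δ′) ∷ [])
         (Γ ∪ Γ′ ∣ Δ ∪ Δ′)

  equality : ∀ {Γ Δ x A y z} →
    Rule ((｛ x ⟨ A ⟩ y ｝ ∪ Γ ∣ Δ) ∷ [])
         (｛ x ⟨ A ⟩ z ｝ ∪ ｛ z ⟨ 1′ ⟩ y ｝ ∪ Γ ∣ Δ)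

  +-left : ∀ {Γ Γ′ Δ Δ′ x A B y} →
    Rule ((｛ x ⟨ A ⟩ y ｝ ∪ Γ ∣ Δ) ∷ (｛ x ⟨ B ⟩ y ｝ ∪ Γ′ ∣ Δ′) ∷ [])
         (｛ x ⟨ A + B ⟩ y ｝ ∪ Γ ∪ Γ′ ∣ Δ ∪ Δ′)

  +-right : ∀ {Γ Δ x A B y} →
    Rule ((Γ ∣ Δ ∪ ｛ x ⟨ A ⟩ y ｝ ∪ ｛ x ⟨ B ⟩ y ｝) ∷ [])
         (Γ ∣ Δ ∪ ｛ x ⟨ A + B ⟩ y ｝)

  ⁻-left : ∀ {Γ Δ x A y} →
    Rule ((Γ ∣ Δ ∪ ｛ x ⟨ A ⟩ y ｝) ∷ [])
         (｛ x ⟨ A ⁻ ⟩ y ｝ ∪ Γ ∣ Δ)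

  ⁻-right : ∀ {Γ Δ x A y} →
    Rule ((｛ x ⟨ A ⟩ y ｝ ∪ Γ ∣ Δ) ∷ [])
         (Γ ∣ Δ ∪ ｛ x ⟨ A ⁻ ⟩ y ｝)

  ⨾-left : ∀ {Γ Δ x A y B z} → y ≢ x → y ≢ z → y NotIn (Γ ∪ Δ) →
    Rule ((｛ x ⟨ A ⟩ y ｝ ∪ ｛ y ⟨ B ⟩ z ｝ ∪ Γ ∣ Δ) ∷ [])
         (｛ x ⟨ A ⨾ B ⟩ z ｝ ∪ Γ ∣ Δ)

  ⨾-right : ∀ {Γ Γ′ Δ Δ′ x A y B z} →
    Rule ((Γ ∣ Δ ∪ ｛ x ⟨ A ⟩ y ｝) ∷ (Γ′ ∣ Δ′ ∪ ｛ y ⟨ B ⟩ z ｝) ∷ [])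
         (Γ ∪ Γ′ ∣ Δ ∪ Δ′ ∪ ｛ x ⟨ A ⨾ B ⟩ z ｝)

  ˘-left : ∀ {Γ Δ x A y} →
    Rule ((｛ x ⟨ A ⟩ y ｝ ∪ Γ ∣ Δ) ∷ [])
         (｛ y ⟨ A ˘ ⟩ x ｝ ∪ Γ ∣ Δ)

  ˘-right : ∀ {Γ Δ x A y} →
    Rule ((Γ ∣ Δ ∪ ｛ x ⟨ A ⟩ y ｝) ∷ [])
         (Γ ∣ Δ ∪ ｛ y ⟨ A ˘ ⟩ x ｝)

-- The least set of sequents containing Θ and the axioms and closed under
-- the rules.
data ProvableSequent {n : ℕ} (Θ : Pred (Sequent n) ℓ) :
                     Pred (Sequent n) (lsuc 0ℓ ⊔ ℓ) where
  hypothesis : ∀ {s} → s ∈ Θ → ProvableSequent Θ s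
  axiom      : ∀ {s} → Axiom s → ProvableSequent Θ s
  rule       : ∀ {ps s} → Rule ps s → All (ProvableSequent Θ) ps →
               ProvableSequent Θ s

data Corresponding {n : ℕ} (Ψ : Pred Equation 0ℓ) :
                   Pred (Sequent n) (lsuc 0ℓ) where
  forward  : ∀ {A B Γ Δ} i j → A ≃ B ∈ Ψ →
    Corresponding Ψ (｛ i ⟨ A ⟩ j ｝ ∪ Γ ∣ ｛ i ⟨ B ⟩ j ｝ ∪ Δ)
  backward : ∀ {A B Γ Δ} i j → A ≃ B ∈ Ψ →
    Corresponding Ψ (｛ i ⟨ B ⟩ j ｝ ∪ Γ ∣ ｛ i ⟨ A ⟩ j ｝ ∪ Δ)

v₀ : .{{NonZero n}} → Fin n
v₀ {suc n} = zero

assertion : (n : ℕ) .{{_ : NonZero n}} → Predicate → Sequent n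
assertion n A = ∅ ∣ ｛ v₀ ⟨ A ⟩ v₀ ｝

Provable : (n : ℕ) .{{_ : NonZero n}} → Pred Predicate (lsuc 0ℓ)
Provable n A = ProvableSequent ∅ (assertion n A)

ProvableFrom : Pred Equation 0ℓ → (n : ℕ) .{{_ : NonZero n}} →
               Pred Predicate (lsuc 0ℓ)
ProvableFrom Ψ n A = ProvableSequent (Corresponding Ψ) (assertion n A)

------------------------------------------------------------------------
-- Proofs and provable rules of inference

_OccursIn_ : Sequent n → List (Sequent n) → Set₁
s OccursIn π = Any (s ≈_) π

data Justified {n : ℕ} (Θ : Pred (Sequent n) ℓ) (π : List (Sequent n)) :
               Pred (Sequent n) (lsuc 0ℓ ⊔ ℓ) where
  hypothesis : ∀ {s} → s ∈ Θ → Justified Θ π s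
  axiom      : ∀ {s} → Axiom s → Justified Θ π s
  rule       : ∀ {ps s} → Rule ps s → All (_OccursIn π) ps → Justified Θ π s

-- Extension Θ π σ: the sequence σ is obtained from π by adjoining sequents,
-- each of them in Θ, an axiom, or inferred by a rule from earlier ones.
-- The latest sequent is at the head of the list.
data Extension {n : ℕ} (Θ : Pred (Sequent n) ℓ) (π : List (Sequent n)) :
               Pred (List (Sequent n)) (lsuc 0ℓ ⊔ ℓ) where
  done : Extension Θ π π
  step : ∀ {σ s} → Extension Θ π σ → Justified Θ σ s → Extension Θ π (s ∷ σ)

Proof : Pred (Sequent n) ℓ → Pred (List (Sequent n)) (lsuc 0ℓ ⊔ ℓ)
Proof Θ = Extension Θ []

infix 20 _⊢_

record Inference : Set where
  constructor _⊢_
  field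
    premises   : List Predicate
    conclusion : Predicate

open Inference

-- The given proof may use any hypotheses Θ; the extension adds only sequents
-- coming from the axioms and rules.
ProvableInference : (n : ℕ) .{{_ : NonZero n}} → Pred Inference (lsuc (lsuc 0ℓ))
ProvableInference n r =
  (Θ : Pred (Sequent n) (lsuc 0ℓ)) (π : List (Sequent n)) → Proof Θ π →
  All (λ A → assertion n A OccursIn π) (premises r) →
  ∃ λ σ → Extension ∅ π σ × assertion n (conclusion r) OccursIn σ

ClosedUnder : Pred Predicate 0ℓ → Pred Inference 0ℓ
ClosedUnder L r = All L (premises r) → conclusion r ∈ L

------------------------------------------------------------------------
-- The first-order formalism with n variables

infixr 30 ¬ᶠ_
infixl 27 _∧ᶠ_
infixl 25 _∨ᶠ_
infixr 24 _⇒_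
infix  23 _⇔_

data Formula (n : ℕ) : Set where
  atom : Atom n → Formula n
  eqn  : Equation → Formula n
  _⇒_  : Formula n → Formula n → Formula n
  ¬ᶠ_  : Formula n → Formula n
  ∀ᶠ   : Fin n → Formula n → Formula n

_∨ᶠ_ _∧ᶠ_ _⇔_ : Formula n → Formula n → Formula n
φ ∨ᶠ ψ = ¬ᶠ φ ⇒ ψ
φ ∧ᶠ ψ = ¬ᶠ (φ ⇒ ¬ᶠ ψ)
φ ⇔ ψ  = (φ ⇒ ψ) ∧ᶠ (ψ ⇒ φ)

∃ᶠ : Fin n → Formula n → Formula n
∃ᶠ x φ = ¬ᶠ ∀ᶠ x (¬ᶠ φ)

Free : Fin n → Formula n → Set
Free x (atom (y ⟨ A ⟩ z)) = x ≡ y ⊎ x ≡ z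
Free x (eqn e)            = ⊥
Free x (φ ⇒ ψ)            = Free x φ ⊎ Free x ψ
Free x (¬ᶠ φ)             = Free x φ
Free x (∀ᶠ y φ)           = x ≢ y × Free x φ

free? : (x : Fin n) (φ : Formula n) → Dec (Free x φ)
free? x (atom (y ⟨ A ⟩ z)) = (x Fin.≟ y) ⊎-dec (x Fin.≟ z)
free? x (eqn e)            = no λ ()
free? x (φ ⇒ ψ)            = free? x φ ⊎-dec free? x ψ
free? x (¬ᶠ φ)             = free? x φ
free? x (∀ᶠ y φ)           = ¬? (x Fin.≟ y) ×-dec free? x φ

-- Universal closure; the quantifier of the variable of least index is outermost.
[_] : Formula n → Formula n
[_] {n} φ = foldr ∀ᶠ φ (filter (λ x → free? x φ) (allFin n))

-- Bound occurrences are interchanged as well.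
interchange : Fin n → Fin n → Formula n → Formula n
interchange x y (atom (u ⟨ A ⟩ w)) = atom (transpose x y u ⟨ A ⟩ transpose x y w)
interchange x y (eqn e)            = eqn e
interchange x y (φ ⇒ ψ)            = interchange x y φ ⇒ interchange x y ψ
interchange x y (¬ᶠ φ)             = ¬ᶠ interchange x y φ
interchange x y (∀ᶠ u φ)           = ∀ᶠ (transpose x y u) (interchange x y φ)

-- The axioms mention v₀, v₁ and v₂, so the number of variables is 3 + k.
module _ {k : ℕ} where

  private
    N = 3 ℕ.+ k

    a₀ a₁ a₂ : Fin N
    a₀ = zero
    a₁ = suc zero
    a₂ = suc (suc zero)

  data FormulaAxiom : Pred (Formula N) 0ℓ where
    syllogism     : ∀ φ ψ ξ → FormulaAxiom [ (φ ⇒ ψ) ⇒ ((ψ ⇒ ξ) ⇒ (φ ⇒ ξ)) ]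
    clavius       : ∀ φ → FormulaAxiom [ (¬ᶠ φ ⇒ φ) ⇒ φ ]
    explosion     : ∀ φ ψ → FormulaAxiom [ φ ⇒ (¬ᶠ φ ⇒ ψ) ]
    ∀-swap        : ∀ x y φ → FormulaAxiom [ ∀ᶠ x (∀ᶠ y φ) ⇒ ∀ᶠ y (∀ᶠ x φ) ]
    ∀-distrib     : ∀ x φ ψ → FormulaAxiom [ ∀ᶠ x (φ ⇒ ψ) ⇒ (∀ᶠ x φ ⇒ ∀ᶠ x ψ) ]
    ∀-elim        : ∀ x φ → FormulaAxiom [ ∀ᶠ x φ ⇒ φ ]
    ∀-vacuous     : ∀ x φ → Nullary.¬ Free x φ → FormulaAxiom [ φ ⇒ ∀ᶠ x φ ]
    ∃-equal       : ∀ x y → x ≢ y → FormulaAxiom [ ∃ᶠ x (atom (x ⟨ 1′ ⟩ y)) ]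
    equal-replace : ∀ x y φ →
      FormulaAxiom [ atom (x ⟨ 1′ ⟩ y) ⇒ (φ ⇒ interchange x y φ) ]
    def-+ : ∀ A B → FormulaAxiom
      [ atom (a₀ ⟨ A + B ⟩ a₁) ⇔ atom (a₀ ⟨ A ⟩ a₁) ∨ᶠ atom (a₀ ⟨ B ⟩ a₁) ]
    def-⁻ : ∀ A → FormulaAxiom
      [ atom (a₀ ⟨ A ⁻ ⟩ a₁) ⇔ ¬ᶠ atom (a₀ ⟨ A ⟩ a₁) ]
    def-⨾ : ∀ A B → FormulaAxiom
      [ atom (a₀ ⟨ A ⨾ B ⟩ a₁) ⇔
        ∃ᶠ a₂ (atom (a₀ ⟨ A ⟩ a₂) ∧ᶠ atom (a₂ ⟨ B ⟩ a₁)) ]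
    def-˘ : ∀ A → FormulaAxiom
      [ atom (a₀ ⟨ A ˘ ⟩ a₁) ⇔ atom (a₁ ⟨ A ⟩ a₀) ]
    def-≃ : ∀ A B → FormulaAxiom
      (eqn (A ≃ B) ⇔ [ atom (a₀ ⟨ A ⟩ a₁) ⇔ atom (a₀ ⟨ B ⟩ a₁) ])

infix 20 _⊢⁺[3+_]_

-- Ψ ⊢⁺[3+ k ] φ: provability of φ from Ψ in the formalism with 3 + k variables.
data _⊢⁺[3+_]_ (Ψ : Pred Equation 0ℓ) (k : ℕ) : Pred (Formula (3 ℕ.+ k)) 0ℓ where
  hypothesis   : ∀ {e} → e ∈ Ψ → Ψ ⊢⁺[3+ k ] eqn e
  axiom        : ∀ {φ} → FormulaAxiom φ → Ψ ⊢⁺[3+ k ] φ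
  modus-ponens : ∀ {φ ψ} → Ψ ⊢⁺[3+ k ] φ ⇒ ψ → Ψ ⊢⁺[3+ k ] φ → Ψ ⊢⁺[3+ k ] ψ

CT₃ CT₄ TR : Pred Predicate 0ℓ
CT₃ A = ∅ ⊢⁺[3+ 0 ] eqn (1′ ≤ A)
CT₄ A = ∅ ⊢⁺[3+ 1 ] eqn (1′ ≤ A)
TR A  = (Density ∪ Commutativity) ⊢⁺[3+ 1 ] eqn (1′ ≤ A)

------------------------------------------------------------------------
-- The predicates and rules of inference in question

module Laws (A B C D : Predicate) where

  I : List Predicate
  I = 𝐭
    ∷ A ∨ ¬ A
    ∷ A ∨ ∼ A
    ∷ []

  II : List Predicate
  II = A ⟶ A
     ∷ ((A ⟶ A) ⟶ B) ⟶ B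
     ∷ A ∨ A ⟶ A
     ∷ A ⟶ A ∨ B
     ∷ B ⟶ A ∨ B
     ∷ A ∨ B ⟶ B ∨ A
     ∷ A ⟶ A ∧ A
     ∷ A ∧ B ⟶ A
     ∷ A ∧ B ⟶ B
     ∷ A ∧ B ⟶ B ∧ A
     ∷ (A ∨ B) ∨ C ⟶ A ∨ (B ∨ C)
     ∷ (A ∧ B) ∧ C ⟶ A ∧ (B ∧ C)
     ∷ (A ∨ B) ∧ C ⟶ (A ∧ C) ∨ (B ∧ C)
     ∷ (A ∧ B) ∨ C ⟶ (A ∨ C) ∧ (B ∨ C)
     ∷ ∼ ∼ A ⟶ A
     ∷ A ⟶ ∼ ∼ A
     ∷ ∼ (A ∨ B) ⟶ ∼ A ∧ ∼ B
     ∷ ∼ (A ∧ B) ⟶ ∼ A ∨ ∼ B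
     ∷ ∼ A ∧ ∼ B ⟶ ∼ (A ∨ B)
     ∷ ∼ A ∨ ∼ B ⟶ ∼ (A ∧ B)
     ∷ ¬ ¬ A ⟶ A
     ∷ A ⟶ ¬ ¬ A
     ∷ ¬ (A ∨ B) ⟶ ¬ A ∧ ¬ B
     ∷ ¬ (A ∧ B) ⟶ ¬ A ∨ ¬ B
     ∷ ¬ A ∧ ¬ B ⟶ ¬ (A ∨ B)
     ∷ ¬ A ∨ ¬ B ⟶ ¬ (A ∧ B)
     ∷ A ⟶ B ∨ ¬ B
     ∷ ¬ A ∧ A ⟶ B
     ∷ []

  III : List Predicate
  III = (A ⟶ B) ∧ (A ⟶ C) ⟶ (A ⟶ B ∧ C)
      ∷ (A ⟶ C) ∧ (B ⟶ C) ⟶ (A ∨ B ⟶ C)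
      ∷ (A ⟶ B) ∧ (C ⟶ D) ⟶ (A ∧ C ⟶ B ∧ D)
      ∷ (A ⟶ B) ∧ (C ⟶ D) ⟶ (A ∨ C ⟶ B ∨ D)
      ∷ (A ⟶ B) ∨ (C ⟶ D) ⟶ (A ∧ C ⟶ B ∨ D)
      ∷ A ∘ B ⟶ ∼ (A ⟶ ∼ B)
      ∷ ∼ (A ⟶ ∼ B) ⟶ A ∘ B
      ∷ (A ⟶ B) ∘ A ⟶ B
      ∷ A ⟶ (B ⟶ A ∘ B)
      ∷ A ⟶ ((B ⟶ ∼ A) ⟶ ∼ B)
      ∷ A ∘ B ∧ C ⟶ A ∘ (B ∧ ∼ D) ∨ (A ∧ C ∘ D) ∘ B
      ∷ A ∘ B ∧ C ⟶ (A ∧ ∼ D) ∘ B ∨ A ∘ (B ∧ D ∘ C)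
      ∷ A ∘ B ∧ C ⟶ (A ∧ C ∘ B *) ∘ (B ∧ A * ∘ C)
      ∷ 𝐭 ∘ A ⟶ A
      ∷ A ∘ 𝐭 ⟶ A
      ∷ A ⟶ A ∘ 𝐭 *
      ∷ 𝐭 ⟶ 𝐭 *
      ∷ 𝐭 * ⟶ 𝐭
      ∷ 𝐭 ∧ ∼ 𝐭 ⟶ A
      ∷ []

  IV : List Inference
  IV = (A ∷ B ∷ []) ⊢ A ∧ B
     ∷ (A ⟶ B ∷ A ∷ []) ⊢ B
     ∷ (A ∨ B ∷ ∼ A ∷ []) ⊢ B
     ∷ (A ∷ []) ⊢ A *
     ∷ []

  V : List Inference
  V = (A ⟶ B ∷ B ⟶ C ∷ []) ⊢ A ⟶ C
    ∷ (A ⟶ B ∷ []) ⊢ ∼ B ⟶ ∼ A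
    ∷ (A ⟶ ∼ B ∷ []) ⊢ B ⟶ ∼ A
    ∷ (A ∧ B ⟶ C ∷ B ⟶ C ∨ A ∷ []) ⊢ B ⟶ C
    ∷ (A ∷ []) ⊢ (A ⟶ B) ⟶ B
    ∷ (A ∧ B ⟶ ¬ C ∷ []) ⊢ A ∧ C ⟶ ¬ B
    ∷ (B ∧ ¬ C ⟶ A ∧ ¬ A ∷ []) ⊢ B ⟶ C
    ∷ (B ∧ C * ⟶ A ∧ ¬ A ∷ []) ⊢ B ⟶ ∼ C
    ∷ []

  VI : List Inference
  VI = (A ⟶ B ∷ []) ⊢ (B ⟶ C) ⟶ (A ⟶ C)
     ∷ (A ⟶ B ∷ []) ⊢ (C ⟶ A) ⟶ (C ⟶ B)
     ∷ (A ⟶ B ∷ C ⟶ D ∷ []) ⊢ (B ⟶ C) ⟶ (A ⟶ D)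
     ∷ (A ⟶ B ∷ C ⟶ D ∷ []) ⊢ A ∘ C ⟶ B ∘ D
     ∷ (A ⟶ (B ⟶ C) ∷ []) ⊢ B ⟶ (∼ C ⟶ ∼ A)
     ∷ []

  VII : List Predicate
  VII = (A ⟶ B) ⟶ ((C ⟶ A) ⟶ (C ⟶ B))
      ∷ (A ⟶ (B ⟶ C)) ⟶ (A ∘ B ⟶ C)
      ∷ (A ∘ B ⟶ C) ⟶ (A ⟶ (B ⟶ C))
      ∷ (A ⟶ B) ⟶ (A ∘ C ⟶ B ∘ C)
      ∷ (A ∘ B) ∘ C ⟶ A ∘ (B ∘ C)
      ∷ A ∘ (B ∘ C) ⟶ (A ∘ B) ∘ C
      ∷ []

  VIII : List Predicate
  VIII = (A ⟶ ∼ A) ⟶ ∼ A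
       ∷ A ∧ B ⟶ A ∘ B
       ∷ (A ⟶ B) ⟶ ∼ A ∨ B
       ∷ []

  IX : List Predicate
  IX = (A ⟶ (A ⟶ B)) ⟶ (A ⟶ B)
     ∷ (A ⟶ (B ⟶ C)) ⟶ (A ∧ B ⟶ C)
     ∷ []

  X : List Predicate
  X = A ⟶ ((A ⟶ B) ⟶ B)
    ∷ (A ⟶ ∼ B) ⟶ (B ⟶ ∼ A)
    ∷ []

  XI : List Predicate
  XI = (A ⟶ (B ⟶ C)) ⟶ (B ⟶ (A ⟶ C))
     ∷ (A ⟶ B) ⟶ ((B ⟶ C) ⟶ (A ⟶ C))
     ∷ []

  XII : List Predicate
  XII = (A ⟶ (B ⟶ C)) ⟶ ((A ⟶ B) ⟶ (A ⟶ C))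
      ∷ []

  XIII : List Predicate
  XIII = A ∧ ∼ A ⟶ B
       ∷ []

  XIV : List Predicate
  XIV = A ∘ B ⟶ B ∘ A
      ∷ []

{-# OPTIONS --safe #-}

-- All laws have short derivations in a finite, cumulative version of the sequent calculus with
-- n variables: a search which decomposes everything invertible, uses the right rule for ⨾ only
-- when one of its premises closes at once, and frees a variable for the left rule by dropping the
-- formulas that contain it, finds them, given suitable instances of density, commutativity and
-- symmetry.  Such derivations are sound for the sequent calculus of the paper, where
-- weakening is a cut with an axiom.
--
-- They are also sound for the first-order formalism.  There universal closures are closed under
-- modus ponens and generalization, so that natural deduction is available, but the axioms say
-- nothing about the atoms xAx.  Reading xAx as ∃w (x1′w ∧ xAw) makes every rule valid; three
-- variables suffice, since an equal copy of a variable can be introduced whenever needed.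
module Submission where

open import Defs
open import Data.Bool using (Bool; T; true; false; if_then_else_; not)
open import Data.Bool.ListAction using (any)
open import Data.Empty using (⊥; ⊥-elim)
open import Data.Fin using (Fin; zero; suc; inject≤)
open import Data.Fin.Permutation.Components using (transpose; transpose-inverse)
import Data.Fin.Properties as Fin
open import Data.List using (List; []; _∷_; _++_; map; filter; foldr; reverse; allFin; concat; concatMap)
open import Data.List.Membership.Propositional using (_∈_; mapWith∈)
open import Data.List.Membership.Propositional.Properties using (∈-allFin; ∈-++⁻; ∈-++⁺ˡ; ∈-++⁺ʳ; ∈-map⁺; ∈-map⁻)
open import Data.List.Properties using (unfold-reverse)
open import Data.List.Relation.Binary.Permutation.Propositional using (↭-sym; ↭⇒↭ₛ)
open import Data.List.Relation.Binary.Permutation.Propositional.Properties using (↭-reverse)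
import Data.List.Relation.Binary.Permutation.Setoid.Properties as Permutation
open import Data.List.Relation.Binary.Subset.Propositional using (_⊆_)
open import Data.List.Relation.Binary.Subset.Propositional.Properties using (⊆-refl; map⁺; ∷⁺ʳ; ∈-∷⁺ʳ; filter-⊆)
open import Data.List.Relation.Unary.All using (All)
open import Data.List.Relation.Unary.All as All using ([]; _∷_)
import Data.List.Relation.Unary.All.Properties as All
open import Data.List.Relation.Unary.AllPairs using ([]; _∷_)
open import Data.List.Relation.Unary.Any using (here; there)
open import Data.List.Relation.Unary.Any.Properties using (reverse⁺)
open import Data.List.Relation.Unary.Unique.Propositional using (Unique)
import Data.List.Relation.Unary.Unique.Propositional.Properties as Unique
open import Data.Maybe as Maybe using (Maybe; just; nothing; maybe′; zipWith; is-just; to-witness-T; _<∣>_; _>>=_)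
open import Data.Nat using (nonZero)
open import Data.Nat as ℕ using (ℕ; zero; suc; z≤n; s≤s)
import Data.Nat.Properties as ℕ
open import Data.Product using (_×_)
open import Data.Product using (∃; _,_; proj₁; proj₂)
open import Data.Sum using (_⊎_; inj₁; inj₂; [_,_]′)
open import Function using (_∘′_; id; case_of_; mk⇔)
open import Function.Definitions using (Injective)
open import Level using (0ℓ; Level)
open import Relation.Binary.Core using (Rel)
open import Relation.Binary.PropositionalEquality
  using (_≡_; _≢_; refl; sym; trans; cong; cong₂; subst; setoid; ≢-sym; module ≡-Reasoning)
open import Relation.Nullary using (Dec; yes; no; does; contradiction)
open import Relation.Nullary.Decidable using (¬?; _×-dec_; dec⇒maybe; dec-true; dec-false; does-⇔)
open import Relation.Unary using (_∪_)
open import Relation.Unary as Unary using (Pred; ∅; ｛_｝)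

open Atom
open Inference

private variable
  ℓ    : Level
  n m  : ℕ
  E E₁ : Rel Predicate 0ℓ
  Γ Δ  : List (Atom n)

-- The first-order axioms drop a quantifier but give no instance at another variable, and
-- `equal-replace` interchanges two variables throughout a formula. From x1′y it leads from xAx to
-- yAy but not to xAy, while the axioms for the operators, stated for v₀ and v₁, speak only of
-- distinct variables. This is the obstacle behind the reading of xAx as ∃w (x1′w ∧ xAw): atoms with
-- distinct variables stay as they are, and a law known for them extends to the diagonal by
-- splitting x into x and an equal copy. The relation `E` lets one derivation serve several clauses.
-- A commutativity or symmetry equation contributes axioms xAy | xBy, and a premise A of a rule
-- contributes x1′y | xAy, which is what asserting A amounts to in either formalism. A rule is thus
-- derived like a law, and both its provability and the closure of the logics under it are read off
-- from that derivation.

Fresh : Fin n → Atom n → Set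
Fresh y φ = y ≢ left φ × y ≢ right φ

fresh? : (y : Fin n) (φ : Atom n) → Dec (Fresh y φ)
fresh? y φ = ¬? (y Fin.≟ left φ) ×-dec ¬? (y Fin.≟ right φ)

infix 4 _∥_⟹_

-- Finite sequents, with all contexts shared and weakening as a rule;
-- E A B provides the axioms xAy | xBy.
data _∥_⟹_ {n : ℕ} (E : Rel Predicate 0ℓ) : List (Atom n) → List (Atom n) → Set where
  weaken    : ∀ {Γ Γ′ Δ Δ′} → Γ ⊆ Γ′ → Δ ⊆ Δ′ → E ∥ Γ ⟹ Δ → E ∥ Γ′ ⟹ Δ′
  common    : ∀ {φ} → E ∥ φ ∷ [] ⟹ φ ∷ []
  reflexive : ∀ x → E ∥ [] ⟹ x ⟨ 1′ ⟩ x ∷ []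
  entail    : ∀ {x A B y} → E A B → E ∥ x ⟨ A ⟩ y ∷ [] ⟹ x ⟨ B ⟩ y ∷ []
  cut       : ∀ {Γ Δ φ} → E ∥ Γ ⟹ φ ∷ Δ → E ∥ φ ∷ Γ ⟹ Δ → E ∥ Γ ⟹ Δ
  equality  : ∀ {x A y z} → E ∥ x ⟨ A ⟩ z ∷ z ⟨ 1′ ⟩ y ∷ [] ⟹ x ⟨ A ⟩ y ∷ []
  +ˡ        : ∀ {Γ Δ x A B y} →
              E ∥ x ⟨ A ⟩ y ∷ Γ ⟹ Δ → E ∥ x ⟨ B ⟩ y ∷ Γ ⟹ Δ → E ∥ x ⟨ A + B ⟩ y ∷ Γ ⟹ Δ
  +ʳ        : ∀ {Γ Δ x A B y} →
              E ∥ Γ ⟹ x ⟨ A ⟩ y ∷ x ⟨ B ⟩ y ∷ Δ → E ∥ Γ ⟹ x ⟨ A + B ⟩ y ∷ Δ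
  ⁻ˡ        : ∀ {Γ Δ x A y} → E ∥ Γ ⟹ x ⟨ A ⟩ y ∷ Δ → E ∥ x ⟨ A ⁻ ⟩ y ∷ Γ ⟹ Δ
  ⁻ʳ        : ∀ {Γ Δ x A y} → E ∥ x ⟨ A ⟩ y ∷ Γ ⟹ Δ → E ∥ Γ ⟹ x ⟨ A ⁻ ⟩ y ∷ Δ
  ⨾ˡ        : ∀ {Γ Δ x A y B z} → y ≢ x → y ≢ z → All (Fresh y) Γ → All (Fresh y) Δ →
              E ∥ x ⟨ A ⟩ y ∷ y ⟨ B ⟩ z ∷ Γ ⟹ Δ → E ∥ x ⟨ A ⨾ B ⟩ z ∷ Γ ⟹ Δ
  ⨾ʳ        : ∀ {Γ Δ x A y B z} →
              E ∥ Γ ⟹ x ⟨ A ⟩ y ∷ Δ → E ∥ Γ ⟹ y ⟨ B ⟩ z ∷ Δ → E ∥ Γ ⟹ x ⟨ A ⨾ B ⟩ z ∷ Δ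
  ˘ˡ        : ∀ {Γ Δ x A y} → E ∥ x ⟨ A ⟩ y ∷ Γ ⟹ Δ → E ∥ y ⟨ A ˘ ⟩ x ∷ Γ ⟹ Δ
  ˘ʳ        : ∀ {Γ Δ x A y} → E ∥ Γ ⟹ x ⟨ A ⟩ y ∷ Δ → E ∥ Γ ⟹ y ⟨ A ˘ ⟩ x ∷ Δ

shared : ∀ {φ} → φ ∈ Γ → φ ∈ Δ → E ∥ Γ ⟹ Δ
shared p q = weaken (∈-∷⁺ʳ p λ ()) (∈-∷⁺ʳ q λ ()) common

useˡ : ∀ {φ} → φ ∈ Γ → E ∥ φ ∷ Γ ⟹ Δ → E ∥ Γ ⟹ Δ
useˡ p = weaken (∈-∷⁺ʳ p ⊆-refl) ⊆-refl

useʳ : ∀ {φ} → φ ∈ Δ → E ∥ Γ ⟹ φ ∷ Δ → E ∥ Γ ⟹ Δ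
useʳ q = weaken ⊆-refl (∈-∷⁺ʳ q ⊆-refl)

reflexive′ : ∀ {x} → E ∥ Γ ⟹ x ⟨ 1′ ⟩ x ∷ Δ
reflexive′ = weaken (λ ()) (∈-∷⁺ʳ (here refl) λ ()) (reflexive _)

-- Left congruence is right congruence for the converse.
equalityˡ : ∀ {x A y z} → x ⟨ 1′ ⟩ y ∈ Γ → x ⟨ A ⟩ z ∈ Γ → E ∥ Γ ⟹ y ⟨ A ⟩ z ∷ Δ
equalityˡ {x = x} {A} {y} {z} p q =
  cut {φ = z ⟨ A ˘ ⟩ x} (˘ʳ (shared q (here refl)))
    (cut {φ = z ⟨ A ˘ ⟩ y}
      (weaken (∈-∷⁺ʳ (here refl) (∈-∷⁺ʳ (there p) λ ())) (∈-∷⁺ʳ (here refl) λ ()) equality)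
      (˘ˡ (shared (here refl) (here refl))))

equalityʳ : ∀ {x A y z} → x ⟨ 1′ ⟩ y ∈ Γ → z ⟨ A ⟩ x ∈ Γ → E ∥ Γ ⟹ z ⟨ A ⟩ y ∷ Δ
equalityʳ p q = weaken (∈-∷⁺ʳ q (∈-∷⁺ʳ p λ ())) (∈-∷⁺ʳ (here refl) λ ()) equality

entail′ : ∀ {x A B y} → E A B → E ∥ x ⟨ A ⟩ y ∷ Γ ⟹ x ⟨ B ⟩ y ∷ Δ
entail′ e = weaken (∈-∷⁺ʳ (here refl) λ ()) (∈-∷⁺ʳ (here refl) λ ()) (entail e)

exchangeʳ : ∀ {φ ψ} → E ∥ Γ ⟹ ψ ∷ φ ∷ Δ → E ∥ Γ ⟹ φ ∷ ψ ∷ Δ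
exchangeʳ = weaken ⊆-refl (∈-∷⁺ʳ (there (here refl)) (∷⁺ʳ _ there))

addˡ : ∀ {φ} → E ∥ Γ ⟹ Δ → E ∥ φ ∷ Γ ⟹ Δ
addˡ = weaken there ⊆-refl

addʳ : ∀ {φ} → E ∥ Γ ⟹ Δ → E ∥ Γ ⟹ φ ∷ Δ
addʳ = weaken ⊆-refl there

-- Only positive answers are needed by the proof search.
samePredicate : (A B : Predicate) → Maybe (A ≡ B)
samePredicate 1′      1′        = just refl
samePredicate (var i) (var j)   = Maybe.map (cong var) (dec⇒maybe (i ℕ.≟ j))
samePredicate (A + B) (A′ + B′) = zipWith (cong₂ _+_) (samePredicate A A′) (samePredicate B B′)
samePredicate (A ⁻)   (A′ ⁻)    = Maybe.map (cong _⁻) (samePredicate A A′)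
samePredicate (A ⨾ B) (A′ ⨾ B′) = zipWith (cong₂ _⨾_) (samePredicate A A′) (samePredicate B B′)
samePredicate (A ˘)   (A′ ˘)    = Maybe.map (cong _˘) (samePredicate A A′)
samePredicate _       _         = nothing

sameAtom : (φ ψ : Atom n) → Maybe (φ ≡ ψ)
sameAtom (x ⟨ A ⟩ y) (x′ ⟨ A′ ⟩ y′) with x Fin.≟ x′ | y Fin.≟ y′
... | yes refl | yes refl = Maybe.map (cong (x ⟨_⟩ y)) (samePredicate A A′)
... | _        | _        = nothing

find : (φ : Atom n) (Γ : List (Atom n)) → Maybe (φ ∈ Γ)
find φ []      = nothing
find φ (ψ ∷ Γ) = Maybe.map here (sameAtom φ ψ) <∣> Maybe.map there (find φ Γ)

-- Proof search

module Search {n : ℕ} (es : List (Predicate × Predicate)) where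

  E′ : Rel Predicate 0ℓ
  E′ A B = (A , B) ∈ es

  module _ (Γ Δ : List (Atom n)) where

    Inferences : (Atom n → Set) → Set
    Inferences P = List (∃ λ φ → Maybe (P φ))

    LeftStep RightStep : Atom n → Set
    LeftStep  φ = E′ ∥ φ ∷ Γ ⟹ Δ → E′ ∥ Γ ⟹ Δ
    RightStep φ = E′ ∥ Γ ⟹ φ ∷ Δ → E′ ∥ Γ ⟹ Δ

    mutual
      -- This is what closing at once means: the formula is taken apart, and its parts are compared
      -- with Γ and Δ only, never with each other. Since Γ and Δ stay fixed, the recursion is
      -- structural in the predicate.
      closeˡ : ∀ x A y → Maybe (E′ ∥ x ⟨ A ⟩ y ∷ Γ ⟹ Δ)
      closeˡ x A y = Maybe.map (shared (here refl)) (find (x ⟨ A ⟩ y) Δ) <∣> closeˡ′ x A y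

      closeˡ′ : ∀ x A y → Maybe (E′ ∥ x ⟨ A ⟩ y ∷ Γ ⟹ Δ)
      closeˡ′ x (A + B) y = zipWith +ˡ (closeˡ x A y) (closeˡ x B y)
      closeˡ′ x (A ⁻)   y = Maybe.map ⁻ˡ (closeʳ x A y)
      closeˡ′ x (A ˘)   y = Maybe.map ˘ˡ (closeˡ y A x)
      closeˡ′ _ _       _ = nothing

      closeʳ : ∀ x A y → Maybe (E′ ∥ Γ ⟹ x ⟨ A ⟩ y ∷ Δ)
      closeʳ x A y = Maybe.map (λ p → shared p (here refl)) (find (x ⟨ A ⟩ y) Γ) <∣> closeʳ′ x A y

      closeʳ′ : ∀ x A y → Maybe (E′ ∥ Γ ⟹ x ⟨ A ⟩ y ∷ Δ)
      closeʳ′ x 1′      y = Maybe.map (λ { refl → reflexive′ }) (dec⇒maybe (x Fin.≟ y))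
      closeʳ′ x (A + B) y = Maybe.map (λ d → +ʳ (exchangeʳ (addʳ d))) (closeʳ x A y)
                        <∣> Maybe.map (λ d → +ʳ (addʳ d)) (closeʳ x B y)
      closeʳ′ x (A ⁻)   y = Maybe.map ⁻ʳ (closeˡ x A y)
      closeʳ′ x (A ⨾ B) y =
        foldr (λ u r → zipWith ⨾ʳ (closeʳ x A u) (closeʳ u B y) <∣> r) nothing (allFin n)
      closeʳ′ x (A ˘)   y = Maybe.map ˘ʳ (closeʳ y A x)
      closeʳ′ _ _       _ = nothing

    congruences : ∀ {φ ψ} → φ ∈ Γ → ψ ∈ Γ → Inferences LeftStep
    congruences {x ⟨ 1′ ⟩ y} {u ⟨ A ⟩ w} p q =
      (y ⟨ A ⟩ w , Maybe.map (λ { refl → cut (equalityˡ p q) }) (dec⇒maybe (u Fin.≟ x))) ∷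
      (u ⟨ A ⟩ y , Maybe.map (λ { refl → cut (equalityʳ p q) }) (dec⇒maybe (w Fin.≟ x))) ∷ []
    congruences p q = []

    -- Forward chaining; `entailmentsʳ` chains backwards. For a pair (1′ , B) the premise closes on
    -- the diagonal and wherever x1′y is in Γ, so B becomes available exactly there.
    entailmentsˡ : ∀ {e} → e ∈ es → Inferences LeftStep
    entailmentsˡ {A , B} e = concatMap (λ x → map (λ y →
      x ⟨ B ⟩ y , Maybe.map (λ d → cut (cut (exchangeʳ (addʳ d)) (entail′ e))) (closeʳ x A y)) (allFin n)) (allFin n)

    entailmentsʳ : ∀ {e φ} → e ∈ es → φ ∈ Δ → ∃ λ φ → Maybe (RightStep φ)
    entailmentsʳ {A , B} {x ⟨ C ⟩ y} e q =
      x ⟨ A ⟩ y , Maybe.map (λ { refl d → cut d (useʳ q (entail′ e)) }) (samePredicate C B)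

    -- One premise of the right rule is closed on the spot, and the other merely enlarges the
    -- succedent, so the search does not branch.
    compositions : ∀ {φ} → φ ∈ Δ → Inferences RightStep
    compositions {x ⟨ A ⨾ B ⟩ z} q = concatMap (λ y →
      (y ⟨ B ⟩ z , Maybe.map (λ d d′ → useʳ q (⨾ʳ d d′)) (closeʳ x A y)) ∷
      (x ⟨ A ⟩ y , Maybe.map (λ d d′ → useʳ q (⨾ʳ d′ d)) (closeʳ y B z)) ∷ []) (allFin n)
    compositions q = []

    leftSteps : Inferences LeftStep
    leftSteps = concat (mapWith∈ Γ λ p → concat (mapWith∈ Γ λ q → congruences p q))
             ++ concat (mapWith∈ es entailmentsˡ)

    rightSteps : Inferences RightStep
    rightSteps = concat (mapWith∈ es λ e → mapWith∈ Δ λ q → entailmentsʳ e q)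
              ++ concat (mapWith∈ Δ compositions)

  firstNew : ∀ {P : Atom n → Set} → List (Atom n) → List (∃ λ φ → Maybe (P φ)) → Maybe (∃ P)
  firstNew Γ []                  = nothing
  firstNew Γ ((φ , nothing) ∷ c) = firstNew Γ c
  firstNew Γ ((φ , just p) ∷ c)  = maybe′ (λ _ → firstNew Γ c) (just (φ , p)) (find φ Γ)

  -- L and R are the formulas of Γ and Δ still to be decomposed; k bounds the number of
  -- steps and d the number of uses of ⨾ˡ on a branch.
  mutual
    search : ℕ → ℕ → (Γ Δ L R : List (Atom n)) → Maybe (E′ ∥ Γ ⟹ Δ)
    search zero    d Γ Δ L       R       = nothing
    search (suc k) d Γ Δ (φ ∷ L) R       = find φ Γ >>= decomposeˡ k d Γ Δ L R
    search (suc k) d Γ Δ []      (φ ∷ R) = find φ Δ >>= decomposeʳ k d Γ Δ R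
    search (suc k) d Γ Δ []      []      with firstNew Γ (leftSteps Γ Δ)
    ... | just (φ , s) = Maybe.map s (assume k d Γ Δ [] [] φ)
    ... | nothing      with firstNew Δ (rightSteps Γ Δ)
    ...   | just (φ , s) = Maybe.map s (refute k d Γ Δ [] [] φ)
    ...   | nothing      = instantiations k d Γ Δ

    assume : ℕ → ℕ → (Γ Δ L R : List (Atom n)) (φ : Atom n) → Maybe (E′ ∥ φ ∷ Γ ⟹ Δ)
    assume k d Γ Δ L R φ with find φ Γ | find φ Δ
    ... | just p  | _       = Maybe.map addˡ (search k d Γ Δ L R)
    ... | nothing | just q  = just (shared (here refl) q)
    ... | nothing | nothing = search k d (φ ∷ Γ) Δ (φ ∷ L) R

    refute : ℕ → ℕ → (Γ Δ L R : List (Atom n)) (φ : Atom n) → Maybe (E′ ∥ Γ ⟹ φ ∷ Δ)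
    refute k d Γ Δ L R φ with find φ Δ | find φ Γ
    ... | just q  | _       = Maybe.map addʳ (search k d Γ Δ L R)
    ... | nothing | just p  = just (shared p (here refl))
    ... | nothing | nothing = search k d Γ (φ ∷ Δ) L (φ ∷ R)

    decomposeˡ : ℕ → ℕ → (Γ Δ L R : List (Atom n)) {φ : Atom n} → φ ∈ Γ → Maybe (E′ ∥ Γ ⟹ Δ)
    decomposeˡ k d Γ Δ L R {x ⟨ A + B ⟩ y} p =
      zipWith (λ d₁ d₂ → useˡ p (+ˡ d₁ d₂)) (assume k d Γ Δ L R (x ⟨ A ⟩ y)) (assume k d Γ Δ L R (x ⟨ B ⟩ y))
    decomposeˡ k d Γ Δ L R {x ⟨ A ⁻ ⟩ y} p =
      Maybe.map (λ d → useˡ p (⁻ˡ d)) (refute k d Γ Δ L R (x ⟨ A ⟩ y))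
    decomposeˡ k d Γ Δ L R {x ⟨ A ˘ ⟩ y} p =
      Maybe.map (λ d → useˡ p (˘ˡ d)) (assume k d Γ Δ L R (y ⟨ A ⟩ x))
    decomposeˡ k d Γ Δ L R p = search k d Γ Δ L R

    decomposeʳ : ℕ → ℕ → (Γ Δ R : List (Atom n)) {φ : Atom n} → φ ∈ Δ → Maybe (E′ ∥ Γ ⟹ Δ)
    decomposeʳ k d Γ Δ R {x ⟨ 1′ ⟩ y} q =
      maybe′ (λ { refl → just (useʳ q reflexive′) }) (search k d Γ Δ [] R) (dec⇒maybe (x Fin.≟ y))
    decomposeʳ k d Γ Δ R {x ⟨ A + B ⟩ y} q =
      Maybe.map (λ p → useʳ q (+ʳ (shared p (there (here refl))))) (find (x ⟨ B ⟩ y) Γ)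
      <∣> Maybe.map (λ d → useʳ q (+ʳ d)) (refute k d Γ (x ⟨ B ⟩ y ∷ Δ) [] (x ⟨ B ⟩ y ∷ R) (x ⟨ A ⟩ y))
    decomposeʳ k d Γ Δ R {x ⟨ A ⁻ ⟩ y} q =
      Maybe.map (λ d → useʳ q (⁻ʳ d)) (assume k d Γ Δ [] R (x ⟨ A ⟩ y))
    decomposeʳ k d Γ Δ R {x ⟨ A ˘ ⟩ y} q =
      Maybe.map (λ d → useʳ q (˘ʳ d)) (refute k d Γ Δ [] R (y ⟨ A ⟩ x))
    decomposeʳ k d Γ Δ R q = search k d Γ Δ [] R

    instantiations : ℕ → ℕ → (Γ Δ : List (Atom n)) → Maybe (E′ ∥ Γ ⟹ Δ)
    instantiations k zero    Γ Δ = nothing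
    instantiations k (suc d) Γ Δ = instantiate k d Γ Δ ⊆-refl

    instantiate : ℕ → ℕ → (Γ Δ : List (Atom n)) → {Γ′ : List (Atom n)} → Γ′ ⊆ Γ → Maybe (E′ ∥ Γ ⟹ Δ)
    instantiate k d Γ Δ {[]}                    _ = nothing
    instantiate k d Γ Δ {x ⟨ A ⨾ B ⟩ z ∷ Γ′} p
      with any (λ y → is-just (find (x ⟨ A ⟩ y) Γ >>= λ _ → find (y ⟨ B ⟩ z) Γ)) (allFin n)
    -- A composition that already has a witness in Γ would yield nothing new.
    ... | true  = instantiate k d Γ Δ {Γ′} (λ q → p (there q))
    ... | false = foldr (λ y r → instantiateAt k d Γ Δ (p (here refl)) y <∣> r)
                      (instantiate k d Γ Δ {Γ′} (λ q → p (there q))) (allFin n)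
    instantiate k d Γ Δ {_ ∷ Γ′} p = instantiate k d Γ Δ {Γ′} (λ q → p (there q))

    -- Formulas in which y occurs are dropped to make y available.
    instantiateAt : ℕ → ℕ → (Γ Δ : List (Atom n)) → ∀ {x A B z} → x ⟨ A ⨾ B ⟩ z ∈ Γ → Fin n → Maybe (E′ ∥ Γ ⟹ Δ)
    instantiateAt k d Γ Δ {x} {A} {B} {z} p y with y Fin.≟ x | y Fin.≟ z
    ... | no y≢x | no y≢z =
      Maybe.map (λ D → useˡ p (weaken (∷⁺ʳ _ (filter-⊆ (fresh? y) Γ)) (filter-⊆ (fresh? y) Δ)
          (⨾ˡ y≢x y≢z (All.all-filter (fresh? y) Γ) (All.all-filter (fresh? y) Δ) D)))
        -- Only the two new formulas await decomposition: the others have been decomposed, and the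
        -- parts of a formula contain the same variables, so they survive the filter together with
        -- it.
        (assume k d (y ⟨ B ⟩ z ∷ filter (fresh? y) Γ) (filter (fresh? y) Δ) (y ⟨ B ⟩ z ∷ []) [] (x ⟨ A ⟩ y))
    ... | _ | _ = nothing

  prove : ∀ A (x : Fin n) → Maybe (E′ ∥ [] ⟹ x ⟨ A ⟩ x ∷ [])
  -- The two bounds serve termination only; they are large enough for all the laws treated below.
  prove A x = refute 100 5 [] [] [] [] (x ⟨ A ⟩ x)

  proveAll : (x : Fin n) (As : List Predicate) → Maybe (All (λ A → E′ ∥ [] ⟹ x ⟨ A ⟩ x ∷ []) As)
  proveAll x []       = just []
  proveAll x (A ∷ As) = zipWith _∷_ (prove A x) (proveAll x As)

-- The sequent calculus of the paper

infixl 31 _[_]ₚ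
_[_]ₚ : Predicate → (ℕ → Predicate) → Predicate
1′      [ ρ ]ₚ = 1′
var i   [ ρ ]ₚ = ρ i
(A + B) [ ρ ]ₚ = A [ ρ ]ₚ + B [ ρ ]ₚ
(A ⁻)   [ ρ ]ₚ = (A [ ρ ]ₚ) ⁻
(A ⨾ B) [ ρ ]ₚ = A [ ρ ]ₚ ⨾ B [ ρ ]ₚ
(A ˘)   [ ρ ]ₚ = (A [ ρ ]ₚ) ˘

module Rename (f : Fin n → Fin m) (f-inj : Injective _≡_ _≡_ f) (ρ : ℕ → Predicate)
  (hyp : ∀ {A B} {x y : Fin m} → E A B → E₁ ∥ x ⟨ A [ ρ ]ₚ ⟩ y ∷ [] ⟹ x ⟨ B [ ρ ]ₚ ⟩ y ∷ []) where

  renameAtom : Atom n → Atom m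
  renameAtom (x ⟨ A ⟩ y) = f x ⟨ A [ ρ ]ₚ ⟩ f y

  renameFresh : ∀ {y} φ → Fresh y φ → Fresh (f y) (renameAtom φ)
  renameFresh _ (p , q) = p ∘′ f-inj , q ∘′ f-inj

  -- Injectivity of `f` preserves the side conditions of `⨾ˡ`. An axiom of `E` need only become
  -- derivable under `hyp`, so a law already derived can be used as an axiom in the derivation of
  -- another.
  rename : E ∥ Γ ⟹ Δ → E₁ ∥ map renameAtom Γ ⟹ map renameAtom Δ
  rename (weaken p q d) = weaken (map⁺ renameAtom p) (map⁺ renameAtom q) (rename d)
  rename common         = common
  rename (reflexive x)  = reflexive (f x)
  rename (entail e)     = hyp e
  rename (cut d₁ d₂)    = cut (rename d₁) (rename d₂)
  rename equality       = equality
  rename (+ˡ d₁ d₂)     = +ˡ (rename d₁) (rename d₂)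
  rename (+ʳ d)         = +ʳ (rename d)
  rename (⁻ˡ d)         = ⁻ˡ (rename d)
  rename (⁻ʳ d)         = ⁻ʳ (rename d)
  rename (⨾ˡ p q r s d) = ⨾ˡ (p ∘′ f-inj) (q ∘′ f-inj)
    (All.map⁺ (All.map (λ {φ} → renameFresh φ) r)) (All.map⁺ (All.map (λ {φ} → renameFresh φ) s)) (rename d)
  rename (⨾ʳ d₁ d₂)     = ⨾ʳ (rename d₁) (rename d₂)
  rename (˘ˡ d)         = ˘ˡ (rename d)
  rename (˘ʳ d)         = ˘ʳ (rename d)

module Sequents {Θ : Pred (Sequent n) ℓ} where

  private variable
    G D : Pred (Atom n) 0ℓ
    φ : Atom n

  Proves : Pred (Atom n) 0ℓ → Pred (Atom n) 0ℓ → Set _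
  Proves G D = ProvableSequent Θ (G ∣ D)

  absorb : ∀ (G : Pred (Atom n) 0ℓ) {X : Pred (Atom n) 0ℓ} → φ Unary.∈ G → X Unary.⊆ G → (｛ φ ｝ ∪ X) Unary.⊆ G
  absorb _ p q (inj₁ refl) = p
  absorb _ p q (inj₂ r)    = q r

  absorbʳ : ∀ (G : Pred (Atom n) 0ℓ) {X : Pred (Atom n) 0ℓ} → φ Unary.∈ G → X Unary.⊆ G → (X ∪ ｛ φ ｝) Unary.⊆ G
  absorbʳ _ p q (inj₂ refl) = p
  absorbʳ _ p q (inj₁ r)    = q r

  join : ∀ (G : Pred (Atom n) 0ℓ) {X : Pred (Atom n) 0ℓ} → X Unary.⊆ G → (G ∪ X) Unary.⊆ G
  join _ p (inj₁ q) = q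
  join _ p (inj₂ q) = p q

  conclude : ∀ {ps G′ D′} → Rule ps (G′ ∣ D′) → All (ProvableSequent Θ) ps →
             G′ Unary.≐ G → D′ Unary.≐ D → Proves G D
  conclude r ds p q = rule (ext (p , q)) (rule r ds ∷ [])

  -- The membership of `φ` in `G′` supplies the cut formula: one premise of the cut is an axiom
  -- because `φ` lies in `G`, the other is the given sequent.
  weakenˡ : ∀ {G′ D′} → φ Unary.∈ G′ → G′ Unary.⊆ G → D′ Unary.⊆ D → Proves G′ D′ → Proves G D
  weakenˡ {φ = φ} {G} {D} {G′} {D′} p i j d =
    conclude (cut {Γ = G} {Γ′ = G′} {Δ = D} {Δ′ = D′})
      (axiom (common (_ , i p , inj₂ refl)) ∷ rule (ext ((inj₂ , absorb G′ p id) , (id , id))) (d ∷ []) ∷ [])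
      (join G i , inj₁) (join D j , inj₁)

  listed : List (Atom n) → Pred (Atom n) 0ℓ
  listed Γ φ = φ ∈ Γ

  module _ (hyp : ∀ {A B} x y → E A B → ∀ {G D} → x ⟨ A ⟩ y Unary.∈ G → x ⟨ B ⟩ y Unary.∈ D → Proves G D) where

    consˡ : ∀ (G : Pred (Atom n) 0ℓ) {Γ} → listed Γ Unary.⊆ G → listed (φ ∷ Γ) Unary.⊆ (｛ φ ｝ ∪ G)
    consˡ _ i (here refl) = inj₁ refl
    consˡ _ i (there p)   = inj₂ (i p)

    consʳ : ∀ (D : Pred (Atom n) 0ℓ) {Δ} → listed Δ Unary.⊆ D → listed (φ ∷ Δ) Unary.⊆ (D ∪ ｛ φ ｝)
    consʳ _ j (here refl) = inj₂ refl
    consʳ _ j (there p)   = inj₁ (j p)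

    -- Quantifying over all larger contexts lets the induction absorb weakening and the difference
    -- between shared and separate contexts.
    sound : E ∥ Γ ⟹ Δ → ∀ {G D} → listed Γ Unary.⊆ G → listed Δ Unary.⊆ D → Proves G D
    sound (weaken p q d)  i j = sound d (i ∘′ p) (j ∘′ q)
    sound common          i j = axiom (common (_ , i (here refl) , j (here refl)))
    sound (reflexive x)   i j = axiom (reflexive x (j (here refl)))
    sound (entail e)      i j = hyp _ _ e (i (here refl)) (j (here refl))
    sound (cut d₁ d₂) {G} {D} i j =
      conclude (cut {Γ = G} {G} {D} {D}) (sound d₁ i (consʳ D j) ∷ sound d₂ (consˡ G i) j ∷ [])
        (join G id , inj₁) (join D id , inj₁)
    sound (equality {x} {A} {y} {z}) {G} {D} i j =
      conclude (equality {Γ = G} {D} {x} {A} {y} {z}) (axiom (common (_ , inj₁ refl , j (here refl))) ∷ [])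
        (absorb G (i (here refl)) (absorb G (i (there (here refl))) id) , inj₂ ∘′ inj₂) (id , id)
    sound (+ˡ d₁ d₂) {G} {D} i j =
      conclude (+-left {Γ = G} {G} {D} {D}) (sound d₁ (consˡ G (i ∘′ there)) j ∷ sound d₂ (consˡ G (i ∘′ there)) j ∷ [])
        (absorb G (i (here refl)) (join G id) , inj₂ ∘′ inj₁) (join D id , inj₁)
    sound (+ʳ {x = x} {A} {B} {y} d) {G} {D} i j =
      conclude (+-right {Γ = G} {D}) (sound d i (λ
          { (here refl) → inj₂ (inj₁ refl) ; (there (here refl)) → inj₂ (inj₂ refl) ; (there (there p)) → inj₁ (j (there p)) }) ∷ [])
        (id , id) (absorbʳ D (j (here refl)) id , inj₁)
    sound (⁻ˡ d) {G} {D} i j =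
      conclude (⁻-left {Γ = G} {D}) (sound d (i ∘′ there) (consʳ D j) ∷ []) (absorb G (i (here refl)) id , inj₂) (id , id)
    sound (⁻ʳ d) {G} {D} i j =
      conclude (⁻-right {Γ = G} {D}) (sound d (consˡ G i) (j ∘′ there) ∷ []) (id , id) (absorbʳ D (j (here refl)) id , inj₁)
    sound (⨾ˡ {Γ} {Δ} y≢x y≢z r s d) {G} i j =
      -- Freshness is known for the lists but not for `G` and the right-hand context, so the rule is
      -- applied to the lists and its conclusion weakened.
      weakenˡ (inj₁ refl) (absorb G (i (here refl)) (i ∘′ there)) j
        (rule (⨾-left {Γ = listed Γ} {listed Δ} y≢x y≢z (λ φ → [ All.lookup r , All.lookup s ]′))
          (sound d (λ { (here refl) → inj₁ refl ; (there (here refl)) → inj₂ (inj₁ refl) ; (there (there p)) → inj₂ (inj₂ p) }) id ∷ []))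
    sound (⨾ʳ d₁ d₂) {G} {D} i j =
      conclude (⨾-right {Γ = G} {G} {D} {D}) (sound d₁ i (consʳ D (j ∘′ there)) ∷ sound d₂ i (consʳ D (j ∘′ there)) ∷ [])
        (join G id , inj₁) (join D (absorbʳ D (j (here refl)) id) , inj₁)
    sound (˘ˡ d) {G} {D} i j =
      conclude (˘-left {Γ = G} {D}) (sound d (consˡ G (i ∘′ there)) j ∷ []) (absorb G (i (here refl)) id , inj₂) (id , id)
    sound (˘ʳ d) {G} {D} i j =
      conclude (˘-right {Γ = G} {D}) (sound d i (consʳ D (j ∘′ there)) ∷ []) (id , id) (absorbʳ D (j (here refl)) id , inj₁)

-- The first-order formalism

-- The variable at the head of the list is quantified innermost.
closure : (Fin n → Bool) → List (Fin n) → Formula n → Formula n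
closure S []      φ = φ
closure S (x ∷ r) φ = closure S r (if S x then ∀ᶠ x φ else φ)

isFree : Formula n → Fin n → Bool
isFree φ x = does (free? x φ)

closure-++ : ∀ (S : Fin n → Bool) r s φ → closure S (r ++ s) φ ≡ closure S s (closure S r φ)
closure-++ S []      s φ = refl
closure-++ S (x ∷ r) s φ = closure-++ S r s _

closure-cong : ∀ (S S′ : Fin n → Bool) r φ → (∀ {x} → x ∈ r → S x ≡ S′ x) → closure S r φ ≡ closure S′ r φ
closure-cong S S′ []      φ e = refl
closure-cong S S′ (x ∷ r) φ e rewrite e (here refl) = closure-cong S S′ r _ (e ∘′ there)

closure-reverse : ∀ (φ ψ : Formula n) vs →
  closure (isFree φ) (reverse vs) ψ ≡ foldr ∀ᶠ ψ (filter (λ x → free? x φ) vs)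
closure-reverse φ ψ []       = refl
closure-reverse φ ψ (x ∷ vs)
  rewrite unfold-reverse x vs | closure-++ (isFree φ) (reverse vs) (x ∷ []) ψ | closure-reverse φ ψ vs
  with free? x φ
... | yes _ = refl
... | no _  = refl

closure-free : ∀ (S : Fin n → Bool) r φ {x} → Free x (closure S r φ) → Free x φ × (x ∈ r → S x ≡ false)
closure-free S []      φ f = f , λ ()
closure-free S (y ∷ r) φ f with S y in e
... | true  = let (x≢y , g) , h = closure-free S r _ f in
              g , λ { (here refl) → contradiction refl x≢y ; (there p) → h p }
... | false = let g , h = closure-free S r _ f in g , λ { (here refl) → e ; (there p) → h p }

variables : List (Fin n)
variables = reverse (allFin _)

[]-closure : (φ : Formula n) → [ φ ] ≡ closure (isFree φ) variables φ
[]-closure φ = sym (closure-reverse φ φ (allFin _))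

∈-variables : (x : Fin n) → x ∈ variables
∈-variables x = reverse⁺ (∈-allFin x)

[]-closed : (φ : Formula n) → ∀ x → Free x [ φ ] → ⊥
[]-closed φ x f =
  let g , h = closure-free (isFree φ) variables φ (subst (Free x) ([]-closure φ) f) in
  case trans (sym (h (∈-variables x))) (dec-true (free? x φ) g) of λ ()

FreeIn : List (Fin n) → Formula n → Set
FreeIn r φ = ∀ {x} → Free x φ → x ∈ r

-- An initial segment of the variables, in reverse order.
record Segment (r : List (Fin n)) : Set where
  field
    unique : Unique r
    closes : ∀ φ → FreeIn r φ → [ φ ] ≡ closure (isFree φ) r φ

open Segment

all-variables : Segment {n} variables
all-variables .unique     = Permutation.Unique-resp-↭ (setoid _) (↭⇒↭ₛ (↭-sym (↭-reverse (allFin _)))) (Unique.allFin⁺ _)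
all-variables .closes φ _ = []-closure φ

fresh-head : ∀ {x : Fin n} {r} φ → Segment (x ∷ r) → FreeIn r φ → Free x φ → ⊥
fresh-head φ s i f with unique s
... | x∉r ∷ _ = All.lookup x∉r (i f) refl

tail : ∀ {x : Fin n} {r} → Segment (x ∷ r) → Segment r
tail s .unique with unique s
... | _ ∷ u = u
tail {x = x} {r} s .closes φ i =
  trans (closes s φ (there ∘′ i))
    (cong (λ b → closure (isFree φ) r (if b then ∀ᶠ x φ else φ)) (dec-false (free? x φ) (fresh-head φ s i)))

∀-freeIn : ∀ {x : Fin n} {r} φ → FreeIn (x ∷ r) φ → FreeIn r (∀ᶠ x φ)
∀-freeIn φ i (x≢y , f) with i f
... | here e  = contradiction e x≢y
... | there p = p

drop-freeIn : ∀ {x : Fin n} {r} φ → (Free x φ → ⊥) → FreeIn (x ∷ r) φ → FreeIn r φ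
drop-freeIn φ x∉φ i f with i f
... | here refl = ⊥-elim (x∉φ f)
... | there p   = p

-- As the head of a segment, x has the largest index among the variables that may be free in `φ`, so
-- its quantifier is the innermost one of the closure.
[]-∀ : ∀ {x : Fin n} {r φ} → Segment (x ∷ r) → FreeIn (x ∷ r) φ → Free x φ → [ φ ] ≡ [ ∀ᶠ x φ ]
[]-∀ {x = x} {r} {φ} s i f = begin
  [ φ ]                                     ≡⟨ closes s φ i ⟩
  closure (isFree φ) (x ∷ r) φ              ≡⟨ cong (λ b → closure (isFree φ) r (if b then ∀ᶠ x φ else φ)) (dec-true (free? x φ) f) ⟩
  closure (isFree φ) r (∀ᶠ x φ)             ≡⟨ closure-cong _ _ r _ agree ⟩
  closure (isFree (∀ᶠ x φ)) r (∀ᶠ x φ)      ≡⟨ closes (tail s) (∀ᶠ x φ) (∀-freeIn φ i) ⟨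
  [ ∀ᶠ x φ ]                                ∎
  where
  open ≡-Reasoning
  agree : ∀ {y} → y ∈ r → isFree φ y ≡ isFree (∀ᶠ x φ) y
  agree {y} p with unique s
  ... | x∉r ∷ _ = does-⇔ (mk⇔ (λ f → (λ e → All.lookup x∉r p (sym e)) , f) proj₂) (free? y φ) (free? y (∀ᶠ x φ))

-- Universal closures under modus ponens and generalization

module Provability (Ψ : Pred Equation 0ℓ) (k : ℕ) where

  N : ℕ
  N = 3 ℕ.+ k

  infix 4 ⊢_
  ⊢_ : Formula N → Set
  ⊢ φ = Ψ ⊢⁺[3+ k ] φ

  Covers : (Fin N → Bool) → Formula N → Set
  Covers S φ = ∀ {x} → Free x φ → S x ≡ true

  ∀-covered : ∀ {S x} φ → Covers S φ → Covers S (∀ᶠ x φ)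
  ∀-covered φ c = c ∘′ proj₂

  not-free : ∀ {S x} φ → Covers S φ → S x ≡ false → Free x φ → ⊥
  not-free φ c e f = case trans (sym e) (c f) of λ ()

  mutual
    -- The closures of φ ⇒ ψ and of φ may have different prefixes, so modus ponens does not apply to
    -- them directly. With a common prefix `S` it is pushed through each quantifier by `∀-distrib`.
    -- The axiom itself has to be brought to the prefix `S`, whence the mutual recursion with
    -- `closure-intro`, which descends along `r`.
    closure-mp : ∀ S r φ ψ → Segment r → FreeIn r (φ ⇒ ψ) → Covers S (φ ⇒ ψ) →
      ⊢ closure S r (φ ⇒ ψ) → ⊢ closure S r φ → ⊢ closure S r ψ
    closure-mp S []      φ ψ s i c d e = modus-ponens d e
    closure-mp S (x ∷ r) φ ψ s i c d e with S x in eq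
    ... | true  =
      closure-mp S r (∀ᶠ x φ) (∀ᶠ x ψ) (tail s) (i′ ∘′ inj₂) (c′ ∘′ inj₂)
        (closure-mp S r (∀ᶠ x (φ ⇒ ψ)) (∀ᶠ x φ ⇒ ∀ᶠ x ψ) (tail s) i′ c′
          (closure-intro S r (∀ᶠ x (φ ⇒ ψ) ⇒ (∀ᶠ x φ ⇒ ∀ᶠ x ψ)) (tail s) i′ c′ (axiom (∀-distrib x φ ψ))) d) e
      where
      i′ : FreeIn r (∀ᶠ x (φ ⇒ ψ) ⇒ (∀ᶠ x φ ⇒ ∀ᶠ x ψ))
      i′ (inj₁ f)                 = ∀-freeIn (φ ⇒ ψ) i f
      i′ (inj₂ (inj₁ (x≢ , f)))   = ∀-freeIn (φ ⇒ ψ) i (x≢ , inj₁ f)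
      i′ (inj₂ (inj₂ (x≢ , f)))   = ∀-freeIn (φ ⇒ ψ) i (x≢ , inj₂ f)
      c′ : Covers S (∀ᶠ x (φ ⇒ ψ) ⇒ (∀ᶠ x φ ⇒ ∀ᶠ x ψ))
      c′ (inj₁ (_ , f))         = c f
      c′ (inj₂ (inj₁ (_ , f)))  = c (inj₁ f)
      c′ (inj₂ (inj₂ (_ , f)))  = c (inj₂ f)
    ... | false = closure-mp S r φ ψ (tail s) (drop-freeIn (φ ⇒ ψ) (not-free (φ ⇒ ψ) c eq) i) c d e

    closure-intro : ∀ S r φ → Segment r → FreeIn r φ → Covers S φ → ⊢ [ φ ] → ⊢ closure S r φ
    closure-intro S []      φ s i c d = subst ⊢_ (closes s φ i) d
    closure-intro S (x ∷ r) φ s i c d with S x in eq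
    ... | false = closure-intro S r φ (tail s) (drop-freeIn φ (not-free φ c eq) i) c d
    ... | true with free? x φ
    ...   | yes f = closure-intro S r (∀ᶠ x φ) (tail s) (∀-freeIn φ i) (∀-covered φ c) (subst ⊢_ ([]-∀ s i f) d)
    -- `S` may quantify variables that are not free; these quantifiers come from `∀-vacuous`.
    ...   | no ¬f =
      closure-mp S r φ (∀ᶠ x φ) (tail s) i′ c′ (closure-intro S r (φ ⇒ ∀ᶠ x φ) (tail s) i′ c′ (axiom (∀-vacuous x φ ¬f)))
        (closure-intro S r φ (tail s) (i′ ∘′ inj₁) c d)
      where
      i′ : FreeIn r (φ ⇒ ∀ᶠ x φ)
      i′ (inj₁ f)       = drop-freeIn φ ¬f i f
      i′ (inj₂ (_ , f)) = drop-freeIn φ ¬f i f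
      c′ : Covers S (φ ⇒ ∀ᶠ x φ)
      c′ (inj₁ f)       = c f
      c′ (inj₂ (_ , f)) = c f

  closure-elim : ∀ S r φ → Segment r → FreeIn r φ → Covers S φ → ⊢ closure S r φ → ⊢ [ φ ]
  closure-elim S []      φ s i c d = subst ⊢_ (sym (closes s φ i)) d
  closure-elim S (x ∷ r) φ s i c d with S x in eq
  ... | false = closure-elim S r φ (tail s) (drop-freeIn φ (not-free φ c eq) i) c d
  ... | true with free? x φ
  ...   | yes f = subst ⊢_ (sym ([]-∀ s i f)) (closure-elim S r (∀ᶠ x φ) (tail s) (∀-freeIn φ i) (∀-covered φ c) d)
  ...   | no ¬f =
    closure-elim S r φ (tail s) (i′ ∘′ inj₂) c
      (closure-mp S r (∀ᶠ x φ) φ (tail s) i′ c′ (closure-intro S r (∀ᶠ x φ ⇒ φ) (tail s) i′ c′ (axiom (∀-elim x φ))) d)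
    where
    i′ : FreeIn r (∀ᶠ x φ ⇒ φ)
    i′ (inj₁ (_ , f)) = drop-freeIn φ ¬f i f
    i′ (inj₂ f)       = drop-freeIn φ ¬f i f
    c′ : Covers S (∀ᶠ x φ ⇒ φ)
    c′ (inj₁ (_ , f)) = c f
    c′ (inj₂ f)       = c f

  record Valid (φ : Formula N) : Set where
    constructor valid
    field closed : ⊢ [ φ ]

  open Valid

  everything : Fin N → Bool
  everything _ = true

  full : ∀ φ → Valid φ → ⊢ closure everything variables φ
  full φ d = closure-intro everything variables φ all-variables (λ _ → ∈-variables _) (λ _ → refl) (closed d)

  unfull : ∀ φ → ⊢ closure everything variables φ → Valid φ
  unfull φ d = valid (closure-elim everything variables φ all-variables (λ _ → ∈-variables _) (λ _ → refl) d)

  mp : ∀ {φ ψ} → Valid (φ ⇒ ψ) → Valid φ → Valid ψ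
  mp {φ} {ψ} d e =
    unfull ψ (closure-mp everything variables φ ψ all-variables (λ _ → ∈-variables _) (λ _ → refl) (full (φ ⇒ ψ) d) (full φ e))

  except : Fin N → Fin N → Bool
  except x y = not (does (x Fin.≟ y))

  except-covers : ∀ {x} φ → (Free x φ → ⊥) → Covers (except x) φ
  except-covers {x} φ ¬f {y} f with x Fin.≟ y
  ... | yes refl = ⊥-elim (¬f f)
  ... | no _     = refl

  -- The quantifier of x moves inwards past one quantifier at a time by `∀-swap`.
  innermost : ∀ x r φ → Segment r → x ∈ r → FreeIn r φ →
    ⊢ closure everything r φ → ⊢ closure (except x) r (∀ᶠ x φ)
  innermost x (y ∷ r) φ s p i d with x Fin.≟ y
  innermost x (y ∷ r) φ s p           i d | yes refl =
    subst ⊢_ (closure-cong everything (except x) r (∀ᶠ x φ) agree) d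
    where
    agree : ∀ {z} → z ∈ r → true ≡ except x z
    agree {z} q with unique s | x Fin.≟ z
    ... | x∉r ∷ _ | yes refl = contradiction refl (All.lookup x∉r q)
    ... | x∉r ∷ _ | no _     = refl
  innermost x (y ∷ r) φ s (here refl) i d | no x≢x = contradiction refl x≢x
  innermost x (y ∷ r) φ s (there p)   i d | no x≢y =
    closure-mp (except x) r (∀ᶠ x (∀ᶠ y φ)) (∀ᶠ y (∀ᶠ x φ)) (tail s) i′ c′
      (closure-intro (except x) r (∀ᶠ x (∀ᶠ y φ) ⇒ ∀ᶠ y (∀ᶠ x φ)) (tail s) i′ c′ (axiom (∀-swap x y φ)))
      (innermost x r (∀ᶠ y φ) (tail s) p (∀-freeIn φ i) d)
    where
    i′ : FreeIn r (∀ᶠ x (∀ᶠ y φ) ⇒ ∀ᶠ y (∀ᶠ x φ))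
    i′ (inj₁ (_ , f))       = ∀-freeIn φ i f
    i′ (inj₂ (z≢y , _ , f)) = ∀-freeIn φ i (z≢y , f)
    c′ : Covers (except x) (∀ᶠ x (∀ᶠ y φ) ⇒ ∀ᶠ y (∀ᶠ x φ))
    c′ = except-covers (∀ᶠ x (∀ᶠ y φ) ⇒ ∀ᶠ y (∀ᶠ x φ)) λ
      { (inj₁ (x≢x , _)) → x≢x refl ; (inj₂ (_ , x≢x , _)) → x≢x refl }

  -- The prefix of all variables already contains ∀x, possibly far from φ. Once it stands innermost,
  -- the remaining prefix avoids x and still covers the free variables of ∀x φ.
  generalize : ∀ x {φ} → Valid φ → Valid (∀ᶠ x φ)
  generalize x {φ} d = valid (
    closure-elim (except x) variables (∀ᶠ x φ) all-variables (λ _ → ∈-variables _) (except-covers (∀ᶠ x φ) λ { (x≢x , _) → x≢x refl })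
      (innermost x variables φ all-variables (∈-variables x) (λ _ → ∈-variables _) (full φ d)))

  []-sentence : ∀ (φ : Formula N) → (∀ x → Free x φ → ⊥) → [ φ ] ≡ φ
  []-sentence φ ¬f = trans ([]-closure φ) (trivial variables)
    where
    trivial : ∀ r → closure (isFree φ) r φ ≡ φ
    trivial []      = refl
    trivial (x ∷ r) = trans (cong (λ b → closure (isFree φ) r (if b then ∀ᶠ x φ else φ)) (dec-false (free? x φ) (¬f x))) (trivial r)

  sentence : ∀ (φ : Formula N) → (∀ x → Free x φ → ⊥) → ⊢ φ → Valid φ
  sentence φ ¬f d = valid (subst ⊢_ (sym ([]-sentence φ ¬f)) d)

  sentence⁻ : ∀ (φ : Formula N) → (∀ x → Free x φ → ⊥) → Valid φ → ⊢ φ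
  sentence⁻ φ ¬f d = subst ⊢_ ([]-sentence φ ¬f) (closed d)

  private variable
    φ ψ ξ θ : Formula N

  -- The derivation of K and S from Łukasiewicz's axioms is that of Metamath.
  luk₁ : Valid ((φ ⇒ ψ) ⇒ ((ψ ⇒ ξ) ⇒ (φ ⇒ ξ)))
  luk₁ {φ} {ψ} {ξ} = valid (axiom (syllogism φ ψ ξ))

  luk₂ : Valid ((¬ᶠ φ ⇒ φ) ⇒ φ)
  luk₂ {φ} = valid (axiom (clavius φ))

  luk₃ : Valid (φ ⇒ (¬ᶠ φ ⇒ ψ))
  luk₃ {φ} {ψ} = valid (axiom (explosion φ ψ))

  syl : Valid (φ ⇒ ψ) → Valid (ψ ⇒ ξ) → Valid (φ ⇒ ξ)
  syl d e = mp (mp luk₁ d) e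

  lemma₂ : Valid ((φ ⇒ ¬ᶠ ψ) ⇒ (((φ ⇒ ξ) ⇒ θ) ⇒ (ψ ⇒ θ)))
  lemma₂ = syl (syl luk₁ (mp luk₁ luk₃)) luk₁

  lemma₃ : Valid (φ ⇒ (((¬ᶠ φ ⇒ ψ) ⇒ ξ) ⇒ (θ ⇒ ξ)))
  lemma₃ = syl luk₃ lemma₂

  lemma₄ : Valid ((((¬ᶠ φ ⇒ φ) ⇒ φ) ⇒ ψ) ⇒ ψ)
  lemma₄ = syl (mp luk₁ (mp (mp lemma₃ luk₂) luk₂)) luk₂

  constant : Valid (φ ⇒ (ψ ⇒ φ))
  constant = syl lemma₃ lemma₄

  contraction : Valid ((φ ⇒ (φ ⇒ ψ)) ⇒ (φ ⇒ ψ))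
  contraction = syl luk₁ (syl (mp luk₁ (syl (syl constant lemma₂) lemma₄)) luk₂)

  exchange : Valid ((φ ⇒ (ψ ⇒ ξ)) ⇒ (ψ ⇒ (φ ⇒ ξ)))
  exchange = syl luk₁ (mp luk₁ (syl constant (syl luk₁ contraction)))

  prefixing : Valid ((φ ⇒ ψ) ⇒ ((ξ ⇒ φ) ⇒ (ξ ⇒ ψ)))
  prefixing = mp exchange luk₁

  substitution : Valid ((φ ⇒ (ψ ⇒ ξ)) ⇒ ((φ ⇒ ψ) ⇒ (φ ⇒ ξ)))
  substitution = syl exchange (syl prefixing (mp prefixing contraction))

-- Interchange of variables

transpose-ˡ : (x y : Fin n) → transpose x y x ≡ y
transpose-ˡ x y rewrite dec-true (x Fin.≟ x) refl = refl

transpose-ʳ : (x y : Fin n) → transpose x y y ≡ x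
transpose-ʳ x y with y Fin.≟ x
... | yes y≡x = y≡x
... | no _ rewrite dec-true (y Fin.≟ y) refl = refl

transpose-≢ : ∀ {x y z : Fin n} → z ≢ x → z ≢ y → transpose x y z ≡ z
transpose-≢ {x = x} {y} {z} z≢x z≢y rewrite dec-false (z Fin.≟ x) z≢x | dec-false (z Fin.≟ y) z≢y = refl

transpose-injective : ∀ (x y : Fin n) {u v} → transpose x y u ≡ transpose x y v → u ≡ v
transpose-injective x y e =
  trans (sym (transpose-inverse y x)) (trans (cong (transpose y x) e) (transpose-inverse y x))

transpose-self : (x u : Fin n) → transpose x x u ≡ u
transpose-self x u with u Fin.≟ x
... | yes u≡x = sym u≡x
... | no u≢x rewrite dec-false (u Fin.≟ x) u≢x = refl

interchange-self : (x : Fin n) (φ : Formula n) → interchange x x φ ≡ φ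
interchange-self x (atom (u ⟨ A ⟩ w)) = cong₂ (λ u w → atom (u ⟨ A ⟩ w)) (transpose-self x u) (transpose-self x w)
interchange-self x (eqn e)            = refl
interchange-self x (φ ⇒ ψ)            = cong₂ _⇒_ (interchange-self x φ) (interchange-self x ψ)
interchange-self x (¬ᶠ φ)             = cong ¬ᶠ_ (interchange-self x φ)
interchange-self x (∀ᶠ u φ)           = cong₂ ∀ᶠ (transpose-self x u) (interchange-self x φ)

interchange-free : ∀ (x y : Fin n) φ {u} → Free u (interchange x y φ) → ∃ λ v → u ≡ transpose x y v × Free v φ
interchange-free x y (atom (u ⟨ A ⟩ w)) (inj₁ e) = u , e , inj₁ refl
interchange-free x y (atom (u ⟨ A ⟩ w)) (inj₂ e) = w , e , inj₂ refl
interchange-free x y (φ ⇒ ψ)  (inj₁ f) = let v , e , g = interchange-free x y φ f in v , e , inj₁ g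
interchange-free x y (φ ⇒ ψ)  (inj₂ f) = let v , e , g = interchange-free x y ψ f in v , e , inj₂ g
interchange-free x y (¬ᶠ φ)   f        = interchange-free x y φ f
interchange-free x y (∀ᶠ z φ) (u≢ , f) =
  let v , e , g = interchange-free x y φ f in
  v , e , (λ { refl → u≢ e }) , g

-- Natural deduction

module Deduction (Ψ : Pred Equation 0ℓ) (k : ℕ) where

  open Provability Ψ k public

  private variable
    φ ψ ξ   : Formula N
    Φ Φ′    : List (Formula N)
    x y z w : Fin N

  infixr 4 _⇒*_
  infix 3 _⊩_

  -- The head of the context becomes the innermost antecedent, which makes the deduction theorem
  -- hold by definition. As `_⇒*_` does not determine its arguments, it is wrapped in the record
  -- `_⊩_`.
  _⇒*_ : List (Formula N) → Formula N → Formula N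
  []      ⇒* φ = φ
  (ψ ∷ Φ) ⇒* φ = Φ ⇒* (ψ ⇒ φ)

  record _⊩_ (Φ : List (Formula N)) (φ : Formula N) : Set where
    constructor entailed
    field implication : Valid (Φ ⇒* φ)

  open _⊩_

  abs : ψ ∷ Φ ⊩ φ → Φ ⊩ ψ ⇒ φ
  abs (entailed d) = entailed d

  unabs : Φ ⊩ ψ ⇒ φ → ψ ∷ Φ ⊩ φ
  unabs (entailed d) = entailed d

  mutual
    theorem′ : Valid φ → Φ ⊩ φ
    theorem′ {Φ = []}    d = entailed d
    theorem′ {Φ = ψ ∷ Φ} d = unabs (app (theorem′ constant) (theorem′ d))

    app : Φ ⊩ φ ⇒ ψ → Φ ⊩ φ → Φ ⊩ ψ
    app {Φ = []}    (entailed d) (entailed e) = entailed (mp d e)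
    app {Φ = ξ ∷ Φ} d            e            = unabs (app (app (theorem′ substitution) (abs d)) (abs e))

  top : φ ∷ Φ ⊩ φ
  -- The identity as SKK; the equation fills a place where any formula would do.
  top = unabs (theorem′ (mp (mp substitution constant) (constant {ψ = eqn (1′ ≃ 1′)})))

  wk : Φ ⊩ φ → ψ ∷ Φ ⊩ φ
  wk d = unabs (app (theorem′ constant) d)

  assumption : φ ∈ Φ → Φ ⊩ φ
  assumption (here refl) = top
  assumption (there p)   = wk (assumption p)

  #1 : ψ ∷ φ ∷ Φ ⊩ φ
  #1 = wk top

  #2 : ξ ∷ ψ ∷ φ ∷ Φ ⊩ φ
  #2 = wk #1

  transfer : (∀ {φ} → φ ∈ Φ → Φ′ ⊩ φ) → Φ ⊩ ψ → Φ′ ⊩ ψ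
  transfer {Φ = []}    s (entailed d) = theorem′ d
  transfer {Φ = φ ∷ Φ} s d            = app (transfer (s ∘′ there) (abs d)) (s (here refl))

  use₁ : φ ∷ [] ⊩ ξ → Φ ⊩ φ → Φ ⊩ ξ
  use₁ d e = transfer (λ { (here refl) → e }) d

  use₂ : φ ∷ ψ ∷ [] ⊩ ξ → Φ ⊩ φ → Φ ⊩ ψ → Φ ⊩ ξ
  use₂ d e f = transfer (λ { (here refl) → e ; (there (here refl)) → f }) d

  explode : Φ ⊩ φ → Φ ⊩ ¬ᶠ φ → Φ ⊩ ψ
  explode d e = app (app (theorem′ luk₃) d) e

  classical : ¬ᶠ φ ∷ Φ ⊩ φ → Φ ⊩ φ
  classical d = app (theorem′ luk₂) (abs d)

  -- Built from an equation, it has no free variables and so never obstructs an eigenvariable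
  -- condition.
  falsum : Formula N
  falsum = ¬ᶠ (eqn (1′ ≃ 1′) ⇒ eqn (1′ ≃ 1′))

  absurd : Φ ⊩ falsum → Φ ⊩ φ
  absurd d = explode (abs top) d

  double : Φ ⊩ ¬ᶠ ¬ᶠ φ → Φ ⊩ φ
  double d = classical (explode top (wk d))

  ¬-intro : φ ∷ Φ ⊩ falsum → Φ ⊩ ¬ᶠ φ
  ¬-intro d = classical (absurd (app (wk (abs d)) (double top)))

  by-contradiction : ¬ᶠ φ ∷ Φ ⊩ falsum → Φ ⊩ φ
  by-contradiction d = classical (absurd d)

  pair : Φ ⊩ φ → Φ ⊩ ψ → Φ ⊩ φ ∧ᶠ ψ
  pair d e = ¬-intro (explode (wk e) (app top (wk d)))

  fst : Φ ⊩ φ ∧ᶠ ψ → Φ ⊩ φ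
  fst d = classical (explode (abs (explode top (wk top))) (wk d))

  snd : Φ ⊩ φ ∧ᶠ ψ → Φ ⊩ ψ
  snd d = classical (explode (abs (wk top)) (wk d))

  FreshFor : Fin N → List (Formula N) → Set
  FreshFor x = All (λ φ → Free x φ → ⊥)

  ∀-intro : FreshFor x Φ → Φ ⊩ φ → Φ ⊩ ∀ᶠ x φ
  ∀-intro {Φ = []}                []      (entailed d) = entailed (generalize _ d)
  ∀-intro {x} {Φ = ψ ∷ Φ} {φ} (f ∷ fs) d =
    unabs (app (theorem′ (mp luk₁ (valid (axiom (∀-vacuous x ψ f)))))
      (app (theorem′ (valid (axiom (∀-distrib x ψ φ)))) (∀-intro fs (abs d))))

  ∀-elim′ : Φ ⊩ ∀ᶠ x φ → Φ ⊩ φ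
  ∀-elim′ {x = x} {φ} d = app (theorem′ (valid (axiom (∀-elim x φ)))) d

  ∃-intro : ∀ x → Φ ⊩ φ → Φ ⊩ ∃ᶠ x φ
  ∃-intro x d = ¬-intro (explode (wk d) (∀-elim′ top))

  ∃-elim : Φ ⊩ ∃ᶠ x φ → φ ∷ Φ ⊩ ψ → FreshFor x (ψ ∷ Φ) → Φ ⊩ ψ
  ∃-elim {x = x} {φ} {ψ} d e (f ∷ fs) =
    by-contradiction (explode (∀-intro (f ∷ fs) (¬-intro (explode
      (transfer (λ { (here refl) → top ; (there p) → wk (wk (assumption p)) }) e) (wk top)))) (wk d))

-- Renaming of variables and translation of atoms

module Translation (Ψ : Pred Equation 0ℓ) (k : ℕ) where

  open Deduction Ψ k public
  open Valid

  private variable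
    φ ψ ξ     : Formula N
    Φ Φ′      : List (Formula N)
    x y z w u : Fin N
    A B       : Predicate

  cut-in : Φ ⊩ φ → φ ∷ Φ ⊩ ψ → Φ ⊩ ψ
  cut-in d e = app (abs e) d

  []-valid : Valid φ → Valid [ φ ]
  []-valid {φ} d = sentence [ φ ] ([]-closed φ) (closed d)

  []-valid⁻ : Valid [ φ ] → Valid φ
  []-valid⁻ {φ} d = valid (sentence⁻ [ φ ] ([]-closed φ) d)

  theorem⁻ : [] ⊩ φ → Valid φ
  theorem⁻ (entailed d) = d

  equal-interchange : Φ ⊩ atom (x ⟨ 1′ ⟩ y) → Φ ⊩ φ → Φ ⊩ interchange x y φ
  equal-interchange {x = x} {y} {φ} d e = app (app (theorem′ (valid (axiom (equal-replace x y φ)))) d) e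

  exists-equal : x ≢ y → Φ ⊩ ∃ᶠ x (atom (x ⟨ 1′ ⟩ y))
  exists-equal {x} {y} x≢y = theorem′ (valid (axiom (∃-equal x y x≢y)))

  interchange-instance : ∀ x y S r φ → Valid (interchange x y (closure S r φ)) → Valid (interchange x y φ)
  interchange-instance x y S []      φ d = d
  interchange-instance x y S (z ∷ r) φ d with S z
  ... | true  = theorem⁻ (∀-elim′ (theorem′ (interchange-instance x y S r (∀ᶠ z φ) d)))
  ... | false = interchange-instance x y S r φ d

  -- The equality axiom is applied to the sentence [ φ ] under the assumption x1′y. The result is
  -- again a sentence, so the assumption is discharged by ∃x (x1′y), and the quantifiers are then
  -- stripped.
  interchange-valid : ∀ x y φ → Valid φ → Valid (interchange x y φ)
  interchange-valid x y φ d with x Fin.≟ y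
  ... | yes refl = subst Valid (sym (interchange-self x φ)) d
  ... | no x≢y   = interchange-instance x y (isFree φ) variables φ
    (subst (λ σ → Valid (interchange x y σ)) ([]-closure φ)
      (theorem⁻ (∃-elim {x = x} {ψ = interchange x y [ φ ]} (exists-equal x≢y) (equal-interchange top (theorem′ ([]-valid d)))
        ((λ f → let v , _ , g = interchange-free x y [ φ ] f in []-closed φ v g) ∷ []))))

  -- Three interchanges stand in for a substitution: the first sends v₀ to x, the second sends the
  -- image of v₁ to y without moving x, the third sends what v₂ has become to z.
  relocate : (F : Fin N → Fin N → Fin N → Formula N) →
    (∀ x y u v w → interchange x y (F u v w) ≡ F (transpose x y u) (transpose x y v) (transpose x y w)) →
    Valid (F zero (suc zero) (suc (suc zero))) → x ≢ y → z ≢ x → z ≢ y → Valid (F x y z)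
  relocate {x} {y} {z} F natural d x≢y z≢x z≢y =
    subst Valid (target (transpose-ˡ c z)) (interchange-valid c z _ d₂)
    where
    one two b c : Fin N
    one = suc zero
    two = suc (suc zero)
    t₁ t₂ : Fin N → Fin N
    t₁ = transpose zero x
    b = t₁ one
    t₂ = transpose b y
    c = t₂ (t₁ two)
    d₁ : Valid (F (t₁ zero) b (t₁ two))
    d₁ = subst Valid (natural zero x zero one two) (interchange-valid zero x _ d)
    d₂ : Valid (F (t₂ (t₁ zero)) (t₂ b) c)
    d₂ = subst Valid (natural b y (t₁ zero) b (t₁ two)) (interchange-valid b y _ d₁)
    t₁-zero : t₁ zero ≡ x
    t₁-zero = transpose-ˡ zero x
    x≢b : x ≢ b
    x≢b e = case transpose-injective zero x {zero} {one} (trans t₁-zero e) of λ ()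
    t₂-x : t₂ x ≡ x
    t₂-x = transpose-≢ x≢b x≢y
    c≢x : c ≢ x
    c≢x e = case transpose-injective zero x {two} {zero}
      (transpose-injective b y {t₁ two} {t₁ zero} (trans e (sym (trans (cong t₂ t₁-zero) t₂-x)))) of λ ()
    c≢y : c ≢ y
    c≢y e = case transpose-injective zero x {two} {one}
      (transpose-injective b y {t₁ two} {b} (trans e (sym (transpose-ˡ b y)))) of λ ()
    target : transpose c z c ≡ z → interchange c z (F (t₂ (t₁ zero)) (t₂ b) c) ≡ F x y z
    target e = trans (natural c z (t₂ (t₁ zero)) (t₂ b) c) (trans
      (cong₂ (λ u v → F (transpose c z u) (transpose c z v) (transpose c z c)) (trans (cong t₂ t₁-zero) t₂-x) (transpose-ˡ b y))
      (trans (cong₂ (λ u v → F u v (transpose c z c)) (transpose-≢ (≢-sym c≢x) (≢-sym z≢x)) (transpose-≢ (≢-sym c≢y) (≢-sym z≢y)))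
        (cong (F x y) e)))

  replaceʳ : x ≢ z → x ≢ y → Φ ⊩ atom (z ⟨ 1′ ⟩ y) → Φ ⊩ atom (x ⟨ A ⟩ z) → Φ ⊩ atom (x ⟨ A ⟩ y)
  replaceʳ {z = z} {y} {Φ = Φ} {A = A} x≢z x≢y d e =
    subst (Φ ⊩_) (cong₂ (λ u w → atom (u ⟨ A ⟩ w)) (transpose-≢ x≢z x≢y) (transpose-ˡ z y)) (equal-interchange d e)

  replaceˡ : x ≢ z → x ≢ y → Φ ⊩ atom (z ⟨ 1′ ⟩ y) → Φ ⊩ atom (z ⟨ A ⟩ x) → Φ ⊩ atom (y ⟨ A ⟩ x)
  replaceˡ {z = z} {y} {Φ = Φ} {A = A} x≢z x≢y d e =
    subst (Φ ⊩_) (cong₂ (λ u w → atom (u ⟨ A ⟩ w)) (transpose-ˡ z y) (transpose-≢ x≢z x≢y)) (equal-interchange d e)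

  -- Here the interchange moves both ends at once, so it yields the converse atom, not one on the
  -- diagonal.
  flip : Φ ⊩ atom (x ⟨ 1′ ⟩ y) → Φ ⊩ atom (x ⟨ A ⟩ y) → Φ ⊩ atom (y ⟨ A ⟩ x)
  flip {Φ} {x} {y} {A} d e =
    subst (Φ ⊩_) (cong₂ (λ u w → atom (u ⟨ A ⟩ w)) (transpose-ˡ x y) (transpose-ʳ x y)) (equal-interchange d e)

  flip₁ : Φ ⊩ atom (x ⟨ 1′ ⟩ y) → Φ ⊩ atom (y ⟨ 1′ ⟩ x)
  flip₁ d = flip d d

  avoid : (x y : Fin N) → ∃ λ w → w ≢ x × w ≢ y
  avoid zero          zero          = suc zero , (λ ()) , λ ()
  avoid zero          (suc zero)    = suc (suc zero) , (λ ()) , λ ()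
  avoid zero          (suc (suc _)) = suc zero , (λ ()) , λ ()
  avoid (suc zero)    zero          = suc (suc zero) , (λ ()) , λ ()
  avoid (suc zero)    (suc _)       = zero , (λ ()) , λ ()
  avoid (suc (suc _)) zero          = suc zero , (λ ()) , λ ()
  avoid (suc (suc _)) (suc _)       = zero , (λ ()) , λ ()

  copy : w ≢ x → FreshFor w (ψ ∷ Φ) → atom (x ⟨ 1′ ⟩ w) ∷ Φ ⊩ ψ → Φ ⊩ ψ
  copy {w} {x} w≢x f d =
    ∃-elim {x = w} (exists-equal w≢x) (cut-in (flip₁ top) (transfer (λ { (here refl) → top ; (there p) → wk (wk (assumption p)) }) d)) f

  near : Fin N → Fin N → Predicate → Formula N
  near w x A = atom (x ⟨ 1′ ⟩ w) ∧ᶠ atom (x ⟨ A ⟩ w)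

  bound : Fin N → Fin N
  bound x = proj₁ (avoid x x)

  bound-≢ : bound x ≢ x
  bound-≢ {x} = proj₁ (proj₂ (avoid x x))

  diagonal : Fin N → Predicate → Formula N
  diagonal x A = ∃ᶠ (bound x) (near (bound x) x A)

  -- The axioms do not relate xAx to the formulas xAy with x ≠ y, whence this translation.
  translate : ∀ x A y → Dec (x ≡ y) → Formula N
  translate x A y (yes _) = diagonal x A
  translate x A y (no _)  = atom (x ⟨ A ⟩ y)

  ⟦_⟧ : Atom N → Formula N
  ⟦ x ⟨ A ⟩ y ⟧ = translate x A y (x Fin.≟ y)

  diagonal-free : ∀ {x A y} → Free y (diagonal x A) → y ≡ x
  diagonal-free (p , inj₁ (inj₁ q)) = q
  diagonal-free (p , inj₁ (inj₂ q)) = contradiction q p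
  diagonal-free (p , inj₂ (inj₁ q)) = q
  diagonal-free (p , inj₂ (inj₂ q)) = contradiction q p

  ⟦⟧-free : ∀ x A y → Free z ⟦ x ⟨ A ⟩ y ⟧ → z ≡ x ⊎ z ≡ y
  ⟦⟧-free x A y f with x Fin.≟ y
  ... | yes _ = inj₁ (diagonal-free {x} {A} f)
  ... | no _  = f

  ⟦⟧-fresh : ∀ {z} φ → Fresh z φ → Free z ⟦ φ ⟧ → ⊥
  ⟦⟧-fresh (x ⟨ A ⟩ y) (p , q) f with ⟦⟧-free x A y f
  ... | inj₁ e = p e
  ... | inj₂ e = q e

  ⟦⟧-off : x ≢ y → ⟦ x ⟨ A ⟩ y ⟧ ≡ atom (x ⟨ A ⟩ y)
  ⟦⟧-off {x} {y} x≢y with x Fin.≟ y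
  ... | yes e = contradiction e x≢y
  ... | no _  = refl

  ⟦⟧-diagonal : ⟦ x ⟨ A ⟩ x ⟧ ≡ diagonal x A
  ⟦⟧-diagonal {x} with x Fin.≟ x
  ... | yes _  = refl
  ... | no x≢x = contradiction refl x≢x

  near-free : Free z (near w x A) → z ≡ x ⊎ z ≡ w
  near-free (inj₁ f) = f
  near-free (inj₂ f) = f

  -- Bound variables cannot be renamed outright: inside the quantifier an equal copy u of w is
  -- introduced, and both conjuncts are moved from w to u.
  rebind : w ≢ x → u ≢ x → ∃ᶠ w (near w x A) ∷ [] ⊩ ∃ᶠ u (near u x A)
  rebind {w} {x} {u} {A} w≢x u≢x with u Fin.≟ w
  ... | yes refl = top
  ... | no u≢w   = ∃-elim {x = w} top
    (copy u≢w ((λ f → proj₁ f refl) ∷ (λ { f → case near-free {A = A} f of λ { (inj₁ e) → u≢x e ; (inj₂ e) → u≢w e } }) ∷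
               (λ { (_ , f) → case near-free {A = A} f of λ { (inj₁ e) → u≢x e ; (inj₂ e) → u≢w e } }) ∷ [])
      (∃-intro u (pair (replaceʳ (≢-sym w≢x) (≢-sym u≢x) top (fst #1)) (replaceʳ (≢-sym w≢x) (≢-sym u≢x) top (snd #1)))))
    ((λ { (w≢u , f) → case near-free {A = A} f of λ { (inj₁ e) → w≢x e ; (inj₂ e) → w≢u e } }) ∷ (λ f → proj₁ f refl) ∷ [])

  -- The bound variable is first changed to a third variable t. Then x1′t and x1′w give t1′w, which
  -- carries xAt to xAw; each step involves a pair of distinct variables.
  diagonal-elim : w ≢ x → Φ ⊩ atom (x ⟨ 1′ ⟩ w) → Φ ⊩ diagonal x A → Φ ⊩ atom (x ⟨ A ⟩ w)
  diagonal-elim {w} {x} {A = A} w≢x d e = use₂ main d e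
    where
    t = proj₁ (avoid x w)
    t≢x = proj₁ (proj₂ (avoid x w))
    t≢w = proj₂ (proj₂ (avoid x w))
    main : atom (x ⟨ 1′ ⟩ w) ∷ diagonal x A ∷ [] ⊩ atom (x ⟨ A ⟩ w)
    main = cut-in (use₁ (rebind bound-≢ t≢x) #1)
      (∃-elim {x = t} top
        (replaceʳ (≢-sym t≢x) (≢-sym w≢x) (replaceˡ w≢x (≢-sym t≢w) (fst top) #2) (snd top))
        ((λ { (inj₁ e) → t≢x e ; (inj₂ e) → t≢w e }) ∷ (λ f → proj₁ f refl) ∷
         (λ { (inj₁ e) → t≢x e ; (inj₂ e) → t≢w e }) ∷ (λ f → t≢x (diagonal-free {x} {A} f)) ∷ []))

  diagonal-intro : w ≢ x → Φ ⊩ atom (x ⟨ 1′ ⟩ w) → Φ ⊩ atom (x ⟨ A ⟩ w) → Φ ⊩ diagonal x A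
  diagonal-intro w≢x d e = use₁ (rebind w≢x bound-≢) (∃-intro _ (pair d e))

-- Soundness of the finite calculus in the first-order formalism

module Soundness (Ψ : Pred Equation 0ℓ) (k : ℕ) where

  open Translation Ψ k public
  open Valid

  private variable
    φ ψ ξ   : Formula N
    Φ Φ′    : List (Formula N)
    x y z   : Fin N
    A B     : Predicate

  translate-congʳ : ∀ x A z y (p : Dec (x ≡ z)) (q : Dec (z ≡ y)) (r : Dec (x ≡ y)) →
    Φ ⊩ translate x A z p → Φ ⊩ translate z 1′ y q → Φ ⊩ translate x A y r
  translate-congʳ x A z y (yes refl) (yes refl) (yes refl) d e = d
  translate-congʳ x A z y (yes refl) (yes refl) (no x≢x)   d e = contradiction refl x≢x
  translate-congʳ x A z y (yes refl) (no x≢y)   (yes x≡y)  d e = contradiction x≡y x≢y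
  translate-congʳ x A z y (yes refl) (no x≢y)   (no _)     d e = diagonal-elim (≢-sym x≢y) e d
  translate-congʳ x A z y (no x≢z)   (yes refl) (yes x≡z)  d e = contradiction x≡z x≢z
  translate-congʳ x A z y (no _)     (yes refl) (no _)     d e = d
  translate-congʳ x A z y (no x≢z)   (no _)     (yes refl) d e = diagonal-intro (≢-sym x≢z) (flip₁ e) d
  translate-congʳ x A z y (no x≢z)   (no _)     (no x≢y)   d e = replaceʳ x≢z x≢y e d

  translate-congˡ : ∀ x A z y (p : Dec (z ≡ x)) (q : Dec (z ≡ y)) (r : Dec (y ≡ x)) →
    Φ ⊩ translate z A x p → Φ ⊩ translate z 1′ y q → Φ ⊩ translate y A x r
  translate-congˡ x A z y (yes refl) (yes refl) (yes refl) d e = d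
  translate-congˡ x A z y (yes refl) (yes refl) (no x≢x)   d e = contradiction refl x≢x
  translate-congˡ x A z y (yes refl) (no x≢y)   (yes refl) d e = contradiction refl x≢y
  translate-congˡ x A z y (yes refl) (no x≢y)   (no y≢x)   d e = flip e (diagonal-elim y≢x e d)
  translate-congˡ x A z y (no z≢x)   (yes refl) (yes z≡x)  d e = contradiction z≡x z≢x
  translate-congˡ x A z y (no _)     (yes refl) (no _)     d e = d
  translate-congˡ x A z y (no z≢x)   (no _)     (yes refl) d e = diagonal-intro z≢x (flip₁ e) (flip e d)
  translate-congˡ x A z y (no z≢x)   (no _)     (no y≢x)   d e = replaceˡ (≢-sym z≢x) (≢-sym y≢x) e d

  congʳ : ∀ x A z y → Φ ⊩ ⟦ x ⟨ A ⟩ z ⟧ → Φ ⊩ ⟦ z ⟨ 1′ ⟩ y ⟧ → Φ ⊩ ⟦ x ⟨ A ⟩ y ⟧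
  congʳ x A z y = translate-congʳ x A z y (x Fin.≟ z) (z Fin.≟ y) (x Fin.≟ y)

  congˡ : ∀ x A z y → Φ ⊩ ⟦ z ⟨ A ⟩ x ⟧ → Φ ⊩ ⟦ z ⟨ 1′ ⟩ y ⟧ → Φ ⊩ ⟦ y ⟨ A ⟩ x ⟧
  congˡ x A z y = translate-congˡ x A z y (z Fin.≟ x) (z Fin.≟ y) (y Fin.≟ x)

  off⁺ : x ≢ y → Φ ⊩ atom (x ⟨ A ⟩ y) → Φ ⊩ ⟦ x ⟨ A ⟩ y ⟧
  off⁺ x≢y = subst (_ ⊩_) (sym (⟦⟧-off x≢y))

  off⁻ : x ≢ y → Φ ⊩ ⟦ x ⟨ A ⟩ y ⟧ → Φ ⊩ atom (x ⟨ A ⟩ y)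
  off⁻ x≢y = subst (_ ⊩_) (⟦⟧-off x≢y)

  ¬off⁺ : x ≢ y → Φ ⊩ ¬ᶠ atom (x ⟨ A ⟩ y) → Φ ⊩ ¬ᶠ ⟦ x ⟨ A ⟩ y ⟧
  ¬off⁺ x≢y = subst (λ φ → _ ⊩ ¬ᶠ φ) (sym (⟦⟧-off x≢y))

  ¬off⁻ : x ≢ y → Φ ⊩ ¬ᶠ ⟦ x ⟨ A ⟩ y ⟧ → Φ ⊩ ¬ᶠ atom (x ⟨ A ⟩ y)
  ¬off⁻ x≢y = subst (λ φ → _ ⊩ ¬ᶠ φ) (⟦⟧-off x≢y)

  ⟦1′⟧-refl : ∀ x → Φ ⊩ ⟦ x ⟨ 1′ ⟩ x ⟧
  ⟦1′⟧-refl {Φ} x = subst (Φ ⊩_) (sym ⟦⟧-diagonal) (theorem′ (theorem⁻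
    (copy bound-≢ ((λ f → bound-≢ (diagonal-free {x} {1′} f)) ∷ []) (diagonal-intro bound-≢ top top))))

  ⟦1′⟧-sym : ∀ x y → Φ ⊩ ⟦ x ⟨ 1′ ⟩ y ⟧ → Φ ⊩ ⟦ y ⟨ 1′ ⟩ x ⟧
  ⟦1′⟧-sym x y d = congˡ x 1′ x y (⟦1′⟧-refl x) d

  ⟦⟧-copy : ∀ {w} → w ≢ x → FreshFor w (ψ ∷ Φ) → ⟦ x ⟨ 1′ ⟩ w ⟧ ∷ Φ ⊩ ψ → Φ ⊩ ψ
  ⟦⟧-copy {x = x} {Φ = Φ} w≢x f d = copy w≢x f (subst (λ φ → φ ∷ Φ ⊩ _) (⟦⟧-off (≢-sym w≢x)) d)

  data Literal : Set where
    pos neg : Predicate → Literal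

  literal : Fin N → Fin N → Literal → Formula N
  literal x y (pos A) = ⟦ x ⟨ A ⟩ y ⟧
  literal x y (neg A) = ¬ᶠ ⟦ x ⟨ A ⟩ y ⟧

  literal-cong : ∀ x l z y → Φ ⊩ ⟦ z ⟨ 1′ ⟩ y ⟧ → Φ ⊩ literal x z l → Φ ⊩ literal x y l
  literal-cong x (pos A) z y e d = congʳ x A z y d e
  literal-cong x (neg A) z y e d =
    ¬-intro (explode (congʳ x A y z top (wk (⟦1′⟧-sym z y e))) (wk d))

  literal-fresh : ∀ x {w} l → w ≢ x → Free w (literal x x l) → ⊥
  literal-fresh x (pos A) w≢x = ⟦⟧-fresh (x ⟨ A ⟩ x) (w≢x , w≢x)
  literal-fresh x (neg A) w≢x = ⟦⟧-fresh (x ⟨ A ⟩ x) (w≢x , w≢x)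

  literals-fresh : ∀ x {w} ls → w ≢ x → FreshFor w (map (literal x x) ls)
  literals-fresh x []       w≢x = []
  literals-fresh x (l ∷ ls) w≢x = literal-fresh x l w≢x ∷ literals-fresh x ls w≢x

  transfer-literals : ∀ x y z ls → Φ ⊩ ⟦ y ⟨ 1′ ⟩ z ⟧ → (∀ {φ} → φ ∈ map (literal x y) ls → Φ ⊩ φ) →
    ∀ {φ} → φ ∈ map (literal x z) ls → Φ ⊩ φ
  transfer-literals x y z (l ∷ ls) e d (here refl) = literal-cong x l y z e (d (here refl))
  transfer-literals x y z (l ∷ ls) e d (there p)   = transfer-literals x y z ls e (d ∘′ there) p

  -- On the diagonal an equal copy of x is taken as second variable: the premises move to the
  -- distinct pair, the given entailment applies there, and its conclusion moves back.
  everywhere : ∀ ls l → (∀ {x y} → x ≢ y → map (literal x y) ls ⊩ literal x y l) →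
    ∀ x y → map (literal x y) ls ⊩ literal x y l
  everywhere ls l d x y with x Fin.≟ y
  ... | no x≢y   = d x≢y
  ... | yes refl = ⟦⟧-copy bound-≢ (literal-fresh x l bound-≢ ∷ literals-fresh x ls bound-≢)
    (literal-cong x l _ x (⟦1′⟧-sym x _ top)
      (transfer (transfer-literals x x _ ls top (wk ∘′ assumption)) (d (≢-sym bound-≢))))

  ⇔-to : Φ ⊩ φ ⇔ ψ → Φ ⊩ φ → Φ ⊩ ψ
  ⇔-to d = app (fst d)

  ⇔-from : Φ ⊩ φ ⇔ ψ → Φ ⊩ ψ → Φ ⊩ φ
  ⇔-from d = app (snd d)

  relocate₂ : (F : Fin N → Fin N → Formula N) →
    (∀ x y u v → interchange x y (F u v) ≡ F (transpose x y u) (transpose x y v)) →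
    Valid (F zero (suc zero)) → x ≢ y → Φ ⊩ F x y
  relocate₂ {x} {y} F natural d x≢y =
    let z , z≢x , z≢y = avoid x y in
    theorem′ (relocate (λ u v _ → F u v) (λ x y u v _ → natural x y u v) d x≢y z≢x z≢y)

  +-axiom : x ≢ y → Φ ⊩ atom (x ⟨ A + B ⟩ y) ⇔ atom (x ⟨ A ⟩ y) ∨ᶠ atom (x ⟨ B ⟩ y)
  +-axiom {A = A} {B} = relocate₂ (λ x y → atom (x ⟨ A + B ⟩ y) ⇔ atom (x ⟨ A ⟩ y) ∨ᶠ atom (x ⟨ B ⟩ y))
    (λ _ _ _ _ → refl) (valid (axiom (def-+ A B)))

  ⁻-axiom : x ≢ y → Φ ⊩ atom (x ⟨ A ⁻ ⟩ y) ⇔ ¬ᶠ atom (x ⟨ A ⟩ y)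
  ⁻-axiom {A = A} = relocate₂ (λ x y → atom (x ⟨ A ⁻ ⟩ y) ⇔ ¬ᶠ atom (x ⟨ A ⟩ y))
    (λ _ _ _ _ → refl) (valid (axiom (def-⁻ A)))

  ˘-axiom : x ≢ y → Φ ⊩ atom (x ⟨ A ˘ ⟩ y) ⇔ atom (y ⟨ A ⟩ x)
  ˘-axiom {A = A} = relocate₂ (λ x y → atom (x ⟨ A ˘ ⟩ y) ⇔ atom (y ⟨ A ⟩ x))
    (λ _ _ _ _ → refl) (valid (axiom (def-˘ A)))

  ⨾-axiom : x ≢ y → z ≢ x → z ≢ y →
    Φ ⊩ atom (x ⟨ A ⨾ B ⟩ y) ⇔ ∃ᶠ z (atom (x ⟨ A ⟩ z) ∧ᶠ atom (z ⟨ B ⟩ y))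
  ⨾-axiom {A = A} {B} x≢y z≢x z≢y = theorem′ (relocate
    (λ x y z → atom (x ⟨ A ⨾ B ⟩ y) ⇔ ∃ᶠ z (atom (x ⟨ A ⟩ z) ∧ᶠ atom (z ⟨ B ⟩ y)))
    (λ _ _ _ _ _ → refl) (valid (axiom (def-⨾ A B))) x≢y z≢x z≢y)

  +-elim : ∀ x y → Φ ⊩ ⟦ x ⟨ A + B ⟩ y ⟧ → Φ ⊩ ¬ᶠ ⟦ x ⟨ A ⟩ y ⟧ → Φ ⊩ ⟦ x ⟨ B ⟩ y ⟧
  +-elim {A = A} {B} x y = use₂ (everywhere (pos (A + B) ∷ neg A ∷ []) (pos B) (λ x≢y →
    off⁺ x≢y (app (⇔-to (+-axiom x≢y) (off⁻ x≢y top)) (¬off⁻ x≢y #1))) x y)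

  +-introˡ : ∀ x y → Φ ⊩ ⟦ x ⟨ A ⟩ y ⟧ → Φ ⊩ ⟦ x ⟨ A + B ⟩ y ⟧
  +-introˡ {A = A} {B} x y = use₁ (everywhere (pos A ∷ []) (pos (A + B)) (λ x≢y →
    off⁺ x≢y (⇔-from (+-axiom x≢y) (abs (explode (off⁻ x≢y #1) top)))) x y)

  +-introʳ : ∀ x y → Φ ⊩ ⟦ x ⟨ B ⟩ y ⟧ → Φ ⊩ ⟦ x ⟨ A + B ⟩ y ⟧
  +-introʳ {B = B} {A} x y = use₁ (everywhere (pos B ∷ []) (pos (A + B)) (λ x≢y →
    off⁺ x≢y (⇔-from (+-axiom x≢y) (abs (off⁻ x≢y #1)))) x y)

  ⁻-elim : ∀ x y → Φ ⊩ ⟦ x ⟨ A ⁻ ⟩ y ⟧ → Φ ⊩ ¬ᶠ ⟦ x ⟨ A ⟩ y ⟧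
  ⁻-elim {A = A} x y = use₁ (everywhere (pos (A ⁻) ∷ []) (neg A) (λ x≢y →
    ¬off⁺ x≢y (⇔-to (⁻-axiom x≢y) (off⁻ x≢y top))) x y)

  ⁻-intro : ∀ x y → Φ ⊩ ¬ᶠ ⟦ x ⟨ A ⟩ y ⟧ → Φ ⊩ ⟦ x ⟨ A ⁻ ⟩ y ⟧
  ⁻-intro {A = A} x y = use₁ (everywhere (neg A ∷ []) (pos (A ⁻)) (λ x≢y →
    off⁺ x≢y (⇔-from (⁻-axiom x≢y) (¬off⁻ x≢y top))) x y)

  -- `everywhere` does not apply, since converse reverses the pair, but the diagonal case uses the
  -- same splitting of x.
  ˘-elim : ∀ x y → Φ ⊩ ⟦ x ⟨ A ˘ ⟩ y ⟧ → Φ ⊩ ⟦ y ⟨ A ⟩ x ⟧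
  ˘-elim {A = A} x y = use₁ (main (x Fin.≟ y))
    where
    main : Dec (x ≡ y) → ⟦ x ⟨ A ˘ ⟩ y ⟧ ∷ [] ⊩ ⟦ y ⟨ A ⟩ x ⟧
    main (no x≢y)   = off⁺ (≢-sym x≢y) (⇔-to (˘-axiom x≢y) (off⁻ x≢y top))
    main (yes refl) = ⟦⟧-copy bound-≢ (literal-fresh x (pos A) bound-≢ ∷ literal-fresh x (pos (A ˘)) bound-≢ ∷ [])
      (congˡ x A _ x (off⁺ bound-≢ (⇔-to (˘-axiom (≢-sym bound-≢)) (off⁻ (≢-sym bound-≢) (congʳ x (A ˘) x _ #1 top)))) (⟦1′⟧-sym x _ top))

  ˘-intro : ∀ x y → Φ ⊩ ⟦ y ⟨ A ⟩ x ⟧ → Φ ⊩ ⟦ x ⟨ A ˘ ⟩ y ⟧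
  ˘-intro {A = A} x y = use₁ (main (x Fin.≟ y))
    where
    main : Dec (x ≡ y) → ⟦ y ⟨ A ⟩ x ⟧ ∷ [] ⊩ ⟦ x ⟨ A ˘ ⟩ y ⟧
    main (no x≢y)   = off⁺ x≢y (⇔-from (˘-axiom x≢y) (off⁻ (≢-sym x≢y) top))
    main (yes refl) = ⟦⟧-copy bound-≢ (literal-fresh x (pos (A ˘)) bound-≢ ∷ literal-fresh x (pos A) bound-≢ ∷ [])
      (congʳ x (A ˘) _ x (off⁺ (≢-sym bound-≢) (⇔-from (˘-axiom (≢-sym bound-≢)) (off⁻ bound-≢ (congˡ x A x _ #1 top)))) (⟦1′⟧-sym x _ top))

  Composition : Fin N → Predicate → Fin N → Predicate → Fin N → Formula N
  Composition x A y B z = ⟦ x ⟨ A ⟩ y ⟧ ∧ᶠ ⟦ y ⟨ B ⟩ z ⟧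

  ⨾-axiom′ : x ≢ z → y ≢ x → y ≢ z → Φ ⊩ ⟦ x ⟨ A ⨾ B ⟩ z ⟧ ⇔ ∃ᶠ y (Composition x A y B z)
  ⨾-axiom′ {A = A} {B} x≢z y≢x y≢z
    rewrite ⟦⟧-off {A = A ⨾ B} x≢z | ⟦⟧-off {A = A} (≢-sym y≢x) | ⟦⟧-off {A = B} y≢z = ⨾-axiom x≢z y≢x y≢z

  -- For x = z the right end is moved to a copy w of x, distinct from y, and moved back under the
  -- quantifier; x, y and w are all the variables needed.
  ⨾-elim : y ≢ x → y ≢ z → Φ ⊩ ⟦ x ⟨ A ⨾ B ⟩ z ⟧ → Φ ⊩ ∃ᶠ y (Composition x A y B z)
  ⨾-elim {y} {x} {z} {A = A} {B} y≢x y≢z = use₁ (main (x Fin.≟ z))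
    where
    w   = proj₁ (avoid x y)
    w≢x = proj₁ (proj₂ (avoid x y))
    w≢y = proj₂ (proj₂ (avoid x y))
    main : Dec (x ≡ z) → ⟦ x ⟨ A ⨾ B ⟩ z ⟧ ∷ [] ⊩ ∃ᶠ y (Composition x A y B z)
    main (no x≢z)   = ⇔-to (⨾-axiom′ x≢z y≢x y≢z) top
    main (yes refl) = ⟦⟧-copy w≢x
      ((λ { (_ , inj₁ f) → ⟦⟧-fresh (x ⟨ A ⟩ y) (w≢x , w≢y) f ; (_ , inj₂ f) → ⟦⟧-fresh (y ⟨ B ⟩ x) (w≢y , w≢x) f }) ∷
       ⟦⟧-fresh (x ⟨ A ⨾ B ⟩ x) (w≢x , w≢x) ∷ [])
      (∃-elim {x = y} (⇔-to (⨾-axiom′ (≢-sym w≢x) y≢x (≢-sym w≢y)) (congʳ x (A ⨾ B) x w #1 top))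
        (∃-intro y (pair (fst top) (congʳ y B w x (snd top) (⟦1′⟧-sym x w #1))))
        ((λ f → proj₁ f refl) ∷ ⟦⟧-fresh (x ⟨ 1′ ⟩ w) (y≢x , ≢-sym w≢y) ∷ ⟦⟧-fresh (x ⟨ A ⨾ B ⟩ x) (y≢x , y≢x) ∷ []))

  ⨾-intro′ : ∀ x y z → y ≢ x → y ≢ z → Φ ⊩ ⟦ x ⟨ A ⟩ y ⟧ → Φ ⊩ ⟦ y ⟨ B ⟩ z ⟧ → Φ ⊩ ⟦ x ⟨ A ⨾ B ⟩ z ⟧
  ⨾-intro′ {A = A} {B} x y z y≢x y≢z = use₂ (main (x Fin.≟ z))
    where
    w   = proj₁ (avoid x y)
    w≢x = proj₁ (proj₂ (avoid x y))
    w≢y = proj₂ (proj₂ (avoid x y))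
    main : Dec (x ≡ z) → ⟦ x ⟨ A ⟩ y ⟧ ∷ ⟦ y ⟨ B ⟩ z ⟧ ∷ [] ⊩ ⟦ x ⟨ A ⨾ B ⟩ z ⟧
    main (no x≢z)   = ⇔-from (⨾-axiom′ x≢z y≢x y≢z) (∃-intro y (pair top #1))
    main (yes refl) = ⟦⟧-copy w≢x
      (⟦⟧-fresh (x ⟨ A ⨾ B ⟩ x) (w≢x , w≢x) ∷ ⟦⟧-fresh (x ⟨ A ⟩ y) (w≢x , w≢y) ∷ ⟦⟧-fresh (y ⟨ B ⟩ x) (w≢y , w≢x) ∷ [])
      (congʳ x (A ⨾ B) w x (⇔-from (⨾-axiom′ (≢-sym w≢x) y≢x (≢-sym w≢y))
        (∃-intro y (pair #1 (congʳ y B x w #2 top)))) (⟦1′⟧-sym x w top))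

  -- An intermediate variable that coincides with an end, or is otherwise not the chosen w, is
  -- replaced by its equal copy w, which differs from both ends.
  ⨾-intro : ∀ x y z → Φ ⊩ ⟦ x ⟨ A ⟩ y ⟧ → Φ ⊩ ⟦ y ⟨ B ⟩ z ⟧ → Φ ⊩ ⟦ x ⟨ A ⨾ B ⟩ z ⟧
  ⨾-intro {A = A} {B} x y z = use₂ (main (w Fin.≟ y))
    where
    w   = proj₁ (avoid x z)
    w≢x = proj₁ (proj₂ (avoid x z))
    w≢z = proj₂ (proj₂ (avoid x z))
    main : Dec (w ≡ y) → ⟦ x ⟨ A ⟩ y ⟧ ∷ ⟦ y ⟨ B ⟩ z ⟧ ∷ [] ⊩ ⟦ x ⟨ A ⨾ B ⟩ z ⟧
    main (yes refl) = ⨾-intro′ x w z w≢x w≢z top #1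
    main (no w≢y)   = ⟦⟧-copy w≢y
      (⟦⟧-fresh (x ⟨ A ⨾ B ⟩ z) (w≢x , w≢z) ∷ ⟦⟧-fresh (x ⟨ A ⟩ y) (w≢x , w≢y) ∷ ⟦⟧-fresh (y ⟨ B ⟩ z) (w≢y , w≢z) ∷ [])
      (⨾-intro′ x w z w≢x w≢z (congʳ x A y w #1 top) (congˡ z B y w #2 top))

  ≃-axiom : ∀ A B → Valid (eqn (A ≃ B) ⇔ [ atom (zero ⟨ A ⟩ suc zero) ⇔ atom (zero ⟨ B ⟩ suc zero) ])
  ≃-axiom A B = sentence (eqn (A ≃ B) ⇔ [ iff ]) (λ { x (inj₁ (inj₁ ())) ; x (inj₁ (inj₂ f)) → []-closed iff x f
                                                  ; x (inj₂ (inj₁ f)) → []-closed iff x f ; x (inj₂ (inj₂ ())) })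
    (axiom (def-≃ A B))
    where
    iff : Formula N
    iff = atom (zero ⟨ A ⟩ suc zero) ⇔ atom (zero ⟨ B ⟩ suc zero)

  ⟦eqn⟧ : Ψ ⊢⁺[3+ k ] eqn (A ≃ B) → x ≢ y → Φ ⊩ ⟦ x ⟨ A ⟩ y ⟧ ⇔ ⟦ x ⟨ B ⟩ y ⟧
  ⟦eqn⟧ {A} {B} {x} {y} d x≢y rewrite ⟦⟧-off {A = A} x≢y | ⟦⟧-off {A = B} x≢y =
    relocate₂ (λ x y → atom (x ⟨ A ⟩ y) ⇔ atom (x ⟨ B ⟩ y)) (λ _ _ _ _ → refl)
      ([]-valid⁻ (theorem⁻ (⇔-to (theorem′ (≃-axiom A B)) (theorem′ (sentence (eqn (A ≃ B)) (λ _ ()) d))))) x≢y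

  module _ (E : Rel Predicate 0ℓ)
    (hyp : ∀ {A B x y} → E A B → x ≢ y → ⟦ x ⟨ A ⟩ y ⟧ ∷ [] ⊩ ⟦ x ⟨ B ⟩ y ⟧) where

    All⊩ None⊩ : List (Formula N) → List (Atom N) → Set
    All⊩  Φ Γ = ∀ {φ} → φ ∈ Γ → Φ ⊩ ⟦ φ ⟧
    None⊩ Φ Δ = ∀ {φ} → φ ∈ Δ → Φ ⊩ ¬ᶠ ⟦ φ ⟧

    infixr 5 _∷ₐ_
    _∷ₐ_ : ∀ {P : Atom N → Set} {φ Γ} → P φ → (∀ {ψ} → ψ ∈ Γ → P ψ) → ∀ {ψ} → ψ ∈ φ ∷ Γ → P ψ
    (p ∷ₐ ps) (here refl) = p
    (p ∷ₐ ps) (there q)   = ps q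

    -- A sequent is read as the inconsistency of every context that proves the formulas of Γ and
    -- refutes those of Δ. Weakening then costs nothing, and the rules become steps of classical
    -- natural deduction.
    inconsistent : E ∥ Γ ⟹ Δ → ∀ {Φ} → All⊩ Φ Γ → None⊩ Φ Δ → Φ ⊩ falsum
    refutable : ∀ φ → E ∥ φ ∷ Γ ⟹ Δ → ∀ {Φ} → All⊩ Φ Γ → None⊩ Φ Δ → Φ ⊩ ¬ᶠ ⟦ φ ⟧
    provable  : ∀ φ → E ∥ Γ ⟹ φ ∷ Δ → ∀ {Φ} → All⊩ Φ Γ → None⊩ Φ Δ → Φ ⊩ ⟦ φ ⟧

    refutable φ d i j = ¬-intro (inconsistent d (_∷ₐ_ {P = λ φ → _ ⊩ ⟦ φ ⟧} top (wk ∘′ i)) (wk ∘′ j))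
    provable φ d i j = by-contradiction (inconsistent d (wk ∘′ i) (_∷ₐ_ {P = λ φ → _ ⊩ ¬ᶠ ⟦ φ ⟧} top (wk ∘′ j)))

    inconsistent (weaken p q d) i j = inconsistent d (i ∘′ p) (j ∘′ q)
    inconsistent common         i j = explode (i (here refl)) (j (here refl))
    inconsistent (reflexive x)  i j = explode (⟦1′⟧-refl x) (j (here refl))
    inconsistent (entail {x} {A} {B} {y} e) i j =
      explode (use₁ (everywhere (pos A ∷ []) (pos B) (hyp e) x y) (i (here refl))) (j (here refl))
    inconsistent (cut {φ = φ} d₁ d₂) i j = explode (provable φ d₁ i j) (refutable φ d₂ i j)
    inconsistent (equality {x} {A} {y} {z}) i j = explode (congʳ x A z y (i (here refl)) (i (there (here refl)))) (j (here refl))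
    inconsistent (+ˡ {x = x} {A} {B} {y} d₁ d₂) i j =
      explode (+-elim x y (i (here refl)) (refutable (x ⟨ A ⟩ y) d₁ (i ∘′ there) j)) (refutable (x ⟨ B ⟩ y) d₂ (i ∘′ there) j)
    inconsistent (+ʳ {x = x} {A} {B} {y} d) i j =
      inconsistent d i
        (_∷ₐ_ {P = λ φ → _ ⊩ ¬ᶠ ⟦ φ ⟧} (¬-intro (explode (+-introˡ x y top) (wk (j (here refl)))))
        (_∷ₐ_ {P = λ φ → _ ⊩ ¬ᶠ ⟦ φ ⟧} (¬-intro (explode (+-introʳ x y top) (wk (j (here refl))))) (j ∘′ there)))
    inconsistent (⁻ˡ {x = x} {A} {y} d) i j = explode (provable (x ⟨ A ⟩ y) d (i ∘′ there) j) (⁻-elim x y (i (here refl)))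
    inconsistent (⁻ʳ {x = x} {A} {y} d) i j = explode (⁻-intro x y (refutable (x ⟨ A ⟩ y) d i (j ∘′ there))) (j (here refl))
    inconsistent (⨾ˡ {Γ} {Δ} {x} {A} {y} {B} {z} y≢x y≢z r s d) {Φ} i j =
      transfer context (∃-elim {x = y} (⨾-elim y≢x y≢z top) main ((λ { (inj₁ ()) ; (inj₂ ()) }) ∷ ⟦⟧-fresh (x ⟨ A ⨾ B ⟩ z) (y≢x , y≢z) ∷ fresh))
      where
      -- The eigenvariable y may be free in `Φ`, so the existential is eliminated over the
      -- translations of the side formulas alone, and the result is transferred to `Φ`.
      Φ₀ : List (Formula N)
      Φ₀ = map ⟦_⟧ Γ ++ map (λ φ → ¬ᶠ ⟦ φ ⟧) Δ
      fresh : FreshFor y Φ₀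
      fresh = All.++⁺ (All.map⁺ (All.map (λ {φ} → ⟦⟧-fresh φ) r)) (All.map⁺ (All.map (λ {φ} → ⟦⟧-fresh φ) s))
      context : ∀ {φ} → φ ∈ ⟦ x ⟨ A ⨾ B ⟩ z ⟧ ∷ Φ₀ → Φ ⊩ φ
      context (here refl) = i (here refl)
      context (there p) with ∈-++⁻ (map ⟦_⟧ Γ) p
      ... | inj₁ q with ∈-map⁻ ⟦_⟧ q
      ...   | _ , q′ , refl = i (there q′)
      context (there p) | inj₂ q with ∈-map⁻ (λ φ → ¬ᶠ ⟦ φ ⟧) q
      ...   | _ , q′ , refl = j q′
      main : Composition x A y B z ∷ ⟦ x ⟨ A ⨾ B ⟩ z ⟧ ∷ Φ₀ ⊩ falsum
      main = inconsistent d
        (_∷ₐ_ {P = λ φ → _ ⊩ ⟦ φ ⟧} (fst top) (_∷ₐ_ {P = λ φ → _ ⊩ ⟦ φ ⟧} (snd top)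
          (λ p → assumption (there (there (∈-++⁺ˡ (∈-map⁺ ⟦_⟧ p)))))))
        (λ p → assumption (there (there (∈-++⁺ʳ (map ⟦_⟧ Γ) (∈-map⁺ (λ φ → ¬ᶠ ⟦ φ ⟧) p)))))
    inconsistent (⨾ʳ {x = x} {A} {y} {B} {z} d₁ d₂) i j =
      explode (⨾-intro x y z (provable (x ⟨ A ⟩ y) d₁ i (j ∘′ there)) (provable (y ⟨ B ⟩ z) d₂ i (j ∘′ there))) (j (here refl))
    inconsistent (˘ˡ {x = x} {A} {y} d) i j = explode (˘-elim y x (i (here refl))) (refutable (x ⟨ A ⟩ y) d (i ∘′ there) j)
    inconsistent (˘ʳ {x = x} {A} {y} d) i j = explode (˘-intro y x (provable (x ⟨ A ⟩ y) d i (j ∘′ there))) (j (here refl))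

    -- The equation 1′ + A ≃ A amounts to v₀1′v₁ implying v₀Av₁. Congruence gives this from the
    -- translation of v₀Av₀.
    correct : ∀ {A} → E ∥ [] ⟹ zero ⟨ A ⟩ zero ∷ [] → Ψ ⊢⁺[3+ k ] eqn (1′ ≤ A)
    correct {A} d = sentence⁻ (eqn (1′ ≤ A)) (λ _ ()) (theorem⁻
      (⇔-from (theorem′ (≃-axiom (1′ + A) A)) (theorem′ ([]-valid (theorem⁻ (pair (abs forwards) (abs backwards)))))))
      where
      one : Fin N
      one = suc zero
      identity : Φ ⊩ atom (zero ⟨ 1′ ⟩ one) → Φ ⊩ atom (zero ⟨ A ⟩ one)
      identity e = congʳ zero A zero one (provable (zero ⟨ A ⟩ zero) d (λ ()) (λ ())) e
      forwards : atom (zero ⟨ 1′ + A ⟩ one) ∷ [] ⊩ atom (zero ⟨ A ⟩ one)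
      forwards = classical (+-elim zero one #1 (¬-intro (explode (identity top) #1)))
      backwards : atom (zero ⟨ A ⟩ one) ∷ [] ⊩ atom (zero ⟨ 1′ + A ⟩ one)
      backwards = +-introʳ zero one top

-- The laws

-- An assumed A enters as x1′y | xAy, so that premises of rules have the same shape as equations and
-- hold at every variable, not only at v₀.
data Entailment (Ψ : Pred Equation 0ℓ) (L : Pred Predicate 0ℓ) : Rel Predicate 0ℓ where
  assumed   : ∀ {A} → L A → Entailment Ψ L 1′ A
  forward   : ∀ {A B} → Ψ (A ≃ B) → Entailment Ψ L A B
  backward  : ∀ {A B} → Ψ (A ≃ B) → Entailment Ψ L B A

module _ {Θ : Pred (Sequent (suc n)) ℓ} where

  open Sequents {Θ = Θ}

  private variable
    G D : Pred (Atom (suc n)) 0ℓ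

  combine : ∀ {φ Γ Δ} → Proves ∅ ｛ φ ｝ → (λ _ _ → ⊥) ∥ φ ∷ Γ ⟹ Δ → listed Γ Unary.⊆ G → listed Δ Unary.⊆ D → Proves G D
  combine {G} {D} {φ} d e i j =
    conclude (cut {Γ = ∅} {Γ′ = G} {Δ = ∅} {Δ′ = D})
      (rule (ext ((id , id) , (inj₂ , λ { (inj₂ p) → p }))) (d ∷ []) ∷
       sound {E = λ _ _ → ⊥} (λ _ _ ()) e (consˡ {E = λ _ _ → ⊥} (λ _ _ ()) G i) j ∷ [])
      ((λ { (inj₂ p) → p }) , inj₂) ((λ { (inj₂ p) → p }) , inj₂)

  -- x(1′;A⁻)x refutes v₀Av₀ uniformly in v₀, which is eliminated by the left rule for ⨾.
  relocate-assertion : ∀ A x → Proves ∅ ｛ zero ⟨ A ⟩ zero ｝ → Proves ∅ ｛ x ⟨ A ⟩ x ｝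
  relocate-assertion A zero        d = d
  relocate-assertion A x@(suc _) d =
    conclude (cut {Γ = ∅} {Γ′ = ∅} {Δ = ｛ x ⟨ A ⟩ x ｝} {Δ′ = ∅} {x = x} {A = 1′ ⨾ A ⁻} {y = x})
      (sound {E = λ _ _ → ⊥} (λ _ _ ()) {Γ = []} {Δ = x ⟨ A ⟩ x ∷ x ⟨ 1′ ⨾ A ⁻ ⟩ x ∷ []}
          (exchangeʳ (⨾ʳ reflexive′ (⁻ʳ (shared (here refl) (here refl))))) (λ ())
          (λ { (here refl) → inj₁ refl ; (there (here refl)) → inj₂ refl }) ∷
       refuted ∷ [])
      ((λ { (inj₁ ()) ; (inj₂ ()) }) , λ ()) ((λ { (inj₁ p) → p ; (inj₂ ()) }) , inj₁)
    where
    refuted : Proves (｛ x ⟨ 1′ ⨾ A ⁻ ⟩ x ｝ ∪ ∅) ∅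
    refuted = rule (⨾-left {Γ = ∅} {Δ = ∅} (λ ()) (λ ()) (λ { φ (inj₁ ()) ; φ (inj₂ ()) }))
      (rule (ext (((λ { (inj₁ p) → inj₂ (inj₁ p) ; (inj₂ (inj₁ p)) → inj₁ p ; (inj₂ (inj₂ ())) }) ,
                   (λ { (inj₁ p) → inj₂ (inj₁ p) ; (inj₂ (inj₁ p)) → inj₁ p ; (inj₂ (inj₂ ())) })) , (id , id)))
        (rule (equality {Γ = ∅} {Δ = ∅} {x = zero} {y = zero} {z = x})
          (rule (⁻-left {Γ = ∅} {Δ = ∅}) (rule (ext ((id , id) , (inj₂ , λ { (inj₂ p) → p }))) (d ∷ []) ∷ []) ∷ []) ∷ []) ∷ [])

  module _ {Ψ : Pred Equation 0ℓ} {L : Pred Predicate 0ℓ}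
    (hyp : ∀ {s : Sequent (suc n)} → Corresponding Ψ s → ProvableSequent Θ s)
    (asserted : ∀ {A} → L A → Proves ∅ ｛ zero ⟨ A ⟩ zero ｝) where

    entailed : ∀ {A B} x y → Entailment Ψ L A B → ∀ {G D} → x ⟨ A ⟩ y Unary.∈ G → x ⟨ B ⟩ y Unary.∈ D → Proves G D
    entailed x y (assumed {A} l) p q =
      -- From xAx and x1′y the equality rule gives xAy.
      combine (relocate-assertion A x (asserted l)) equality (λ { (here refl) → p }) (λ { (here refl) → q })
    entailed x y (forward e) {G} {D} p q =
      rule (ext ((absorb G p id , inj₂) , (absorb D q id , inj₂))) (hyp (forward x y e) ∷ [])
    entailed x y (backward e) {G} {D} p q =
      rule (ext ((absorb G p id , inj₂) , (absorb D q id , inj₂))) (hyp (backward x y e) ∷ [])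

    derive : ∀ {A} → Entailment Ψ L ∥ [] ⟹ zero ⟨ A ⟩ zero ∷ [] → Proves ∅ ｛ zero ⟨ A ⟩ zero ｝
    derive d = sound entailed d (λ ()) λ { (here refl) → refl }

-- From derivation trees to proofs as sequences

≈-refl : {s : Sequent n} → s ≈ s
≈-refl = (id , id) , (id , id)

extension-mono : ∀ {Θ : Pred (Sequent n) ℓ} {π σ} → Extension Θ π σ → ∀ {s} → s OccursIn π → s OccursIn σ
extension-mono done       = id
extension-mono (step e _) = there ∘′ extension-mono e

module _ {π : List (Sequent n)} where

  Extended : List (Sequent n) → (List (Sequent n) → Set₁) → Set₁
  Extended σ P = ∃ λ τ → Extension ∅ π τ × (∀ {s} → s OccursIn σ → s OccursIn τ) × P τ

  mutual
    -- The premises of each rule are adjoined one after the other before its conclusion. The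
    -- inclusion carried by `Extended` keeps earlier premises available while later ones are
    -- adjoined.
    linearize : ∀ {s σ} → ProvableSequent (_OccursIn π) s → Extension ∅ π σ → Extended σ (s OccursIn_)
    linearize (hypothesis h) e = _ , e , id , extension-mono e h
    linearize (axiom a)      e = _ , step e (axiom a) , there , here ≈-refl
    linearize (rule r ds)    e with linearizeAll ds e
    ... | _ , e′ , i , os = _ , step e′ (rule r os) , there ∘′ i , here ≈-refl

    linearizeAll : ∀ {ps σ} → All (ProvableSequent (_OccursIn π)) ps → Extension ∅ π σ →
                   Extended σ (λ τ → All (_OccursIn τ) ps)
    linearizeAll []       e = _ , e , id , []
    linearizeAll (d ∷ ds) e with linearize d e
    ... | _ , e₁ , i , o with linearizeAll ds e₁
    ...   | _ , e₂ , j , os = _ , e₂ , j ∘′ i , j o ∷ os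

Logic : Pred Equation 0ℓ → ℕ → Pred Predicate 0ℓ
Logic Ψ k A = Ψ ⊢⁺[3+ k ] eqn (1′ ≤ A)

-- The index is one less than the number of variables, which makes v₀ available.
Holds : Rel Predicate 0ℓ → (n : ℕ) → Predicate → Set
Holds E n A = E ∥ [] ⟹ zero {n} ⟨ A ⟩ zero ∷ []

Entailed : Rel Predicate 0ℓ → ℕ → Predicate × Predicate → Set
Entailed E n (A , B) = ∀ {x y : Fin (suc n)} → E ∥ x ⟨ A ⟩ y ∷ [] ⟹ x ⟨ B ⟩ y ∷ []

module _ {Ψ : Pred Equation 0ℓ} {k : ℕ} where

  open Soundness Ψ k

  -- The assumed predicates are the members of the logic itself, so this gives membership of the
  -- laws and closure under the rules alike.
  logic : ∀ {A} → Holds (Entailment Ψ (Logic Ψ k)) (2 ℕ.+ k) A → Logic Ψ k A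
  logic = correct (Entailment Ψ (Logic Ψ k)) interpret
    where
    interpret : ∀ {A B x y} → Entailment Ψ (Logic Ψ k) A B → x ≢ y → ⟦ x ⟨ A ⟩ y ⟧ ∷ [] ⊩ ⟦ x ⟨ B ⟩ y ⟧
    interpret (assumed l)  x≢y = ⇔-to (⟦eqn⟧ l x≢y) (+-introˡ _ _ top)
    interpret (forward e)  x≢y = ⇔-to (⟦eqn⟧ (hypothesis e) x≢y) top
    interpret (backward e) x≢y = ⇔-from (⟦eqn⟧ (hypothesis e) x≢y) top

-- Derivations for propositional variables and their instances

open Search using (E′; prove; proveAll)

-- The laws are proved for propositional variables, on which the search can compute, and then
-- instantiated.
private
  A B C D : Predicate
  A = var 0
  B = var 1
  C = var 2
  D = var 3

values : (A B C D : Predicate) → ℕ → Predicate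
values A B C D 0 = A
values A B C D 1 = B
values A B C D 2 = C
values A B C D _ = D

_[_]ᵢ : Inference → (ℕ → Predicate) → Inference
r [ ρ ]ᵢ = map (_[ ρ ]ₚ) (premises r) ⊢ conclusion r [ ρ ]ₚ

premisePairs : Inference → List (Predicate × Predicate)
premisePairs r = map (1′ ,_) (premises r)

HoldsInference : ℕ → Inference → Set
HoldsInference n r = Holds (E′ {suc n} (premisePairs r)) n (conclusion r)

proveInferences : ∀ n rs → Maybe (All (HoldsInference n) rs)
proveInferences n []       = just []
proveInferences n (r ∷ rs) = zipWith _∷_ (prove (premisePairs r) (conclusion r) zero) (proveInferences n rs)

module Schematic where

  open Laws A B C D

  laws₁ : All (Holds (E′ {1} []) 0) I
  -- Checking the term runs the search: its success reduces the type of the last argument to the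
  -- unit type.
  laws₁ = to-witness-T (proveAll [] (zero {0}) I) _

  laws₂ : All (Holds (E′ {2} []) 1) II
  laws₂ = to-witness-T (proveAll [] (zero {1}) II) _

  laws₃ : All (Holds (E′ {3} []) 2) III
  laws₃ = to-witness-T (proveAll [] (zero {2}) III) _

  laws₄ : All (Holds (E′ {4} []) 3) VII
  laws₄ = to-witness-T (proveAll [] (zero {3}) VII) _

  rules₁ : All (HoldsInference 0) IV
  rules₁ = to-witness-T (proveInferences 0 IV) _

  rules₂ : All (HoldsInference 1) V
  rules₂ = to-witness-T (proveInferences 1 V) _

  rules₃ : All (HoldsInference 2) VI
  rules₃ = to-witness-T (proveInferences 2 VI) _

open Schematic

searched : ∀ {n} es P → {T (is-just (prove {suc n} es P zero))} → Holds (E′ {suc n} es) n P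
searched es P {t} = to-witness-T (prove es P zero) t

module Instances {E : Rel Predicate 0ℓ} {m : ℕ} (ρ : ℕ → Predicate) where

  Available : List (Predicate × Predicate) → Set
  Available = All (λ (A , B) → Entailed E m (A [ ρ ]ₚ , B [ ρ ]ₚ))

  -- The variables are embedded into the larger calculus and then v₀ is exchanged with x; both maps
  -- are injective, as `rename` requires.
  instanceAt : ∀ {n es P} → n ℕ.≤ m → Available es → ∀ x → Holds (E′ {suc n} es) n P → E ∥ [] ⟹ x ⟨ P [ ρ ]ₚ ⟩ x ∷ []
  instanceAt {P = P} n≤m hs x d =
    subst (λ y → E ∥ [] ⟹ y ⟨ P [ ρ ]ₚ ⟩ y ∷ []) (transpose-ˡ zero x)
      (Rename.rename (λ i → transpose zero x (inject≤ i (s≤s n≤m)))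
        (λ e → Fin.inject≤-injective (s≤s n≤m) (s≤s n≤m) _ _ (transpose-injective zero x e))
        ρ (λ e → All.lookup hs e) d)

  law : ∀ {n} → n ℕ.≤ m → ∀ es → Available es → ∀ P →
    {T (is-just (prove {suc n} es P zero))} → Holds E m (P [ ρ ]ₚ)
  law n≤m es hs P {t} = instanceAt n≤m hs zero (searched es P {t})

  laws : ∀ {n Ps} → n ℕ.≤ m → All (Holds (E′ {suc n} []) n) Ps → All (Holds E m) (map (_[ ρ ]ₚ) Ps)
  laws n≤m ds = All.map⁺ (All.map (instanceAt n≤m [] zero) ds)

  inference : ∀ {n} r → n ℕ.≤ m → HoldsInference n r →
    (∀ {P} → P ∈ premises (r [ ρ ]ᵢ) → E 1′ P) → Holds E m (conclusion (r [ ρ ]ᵢ))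
  inference r n≤m d h = instanceAt n≤m (All.map⁺ (All.tabulate λ p → entail (h (∈-map⁺ _[ ρ ]ₚ p)))) zero d

dense : Predicate → Predicate × Predicate
dense A = A , A ⨾ A

commute : Predicate → Predicate → Predicate × Predicate
commute A B = A ⨾ B , B ⨾ A

-- If A ⟶ C fails at (x, y), some u has uAx but not uCy. Density splits uAx into uAw and wAx, which
-- refutes A ⟶ (A ⟶ C) at (x, y).
contraction : Holds (E′ {4} (dense A ∷ [])) 3 ((A ⟶ (A ⟶ C)) ⟶ (A ⟶ C))
contraction = searched _ _

-- A failure of B ⟶ (A ⟶ C) begins with a step along B ˘ followed by one along A ˘, while the
-- hypothesis speaks of these steps in the opposite order.
permutation : Holds (E′ {4} (commute (B ˘) (A ˘) ∷ [])) 3 ((A ⟶ (B ⟶ C)) ⟶ (B ⟶ (A ⟶ C)))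
permutation = searched _ _

universal : ∀ {A} → (∀ x → E ∥ [] ⟹ x ⟨ A ⟩ x ∷ []) → Entailed E m (1′ , A)
universal d {x} = cut (weaken (λ ()) (∈-∷⁺ʳ (here refl) λ ()) (d x)) equality

module _ {E : Rel Predicate 0ℓ} {m : ℕ} (A′ B′ C′ D′ : Predicate) where

  open Instances {E} {m} (values A′ B′ C′ D′)
  open Laws A′ B′ C′ D′

  module _ (h : ∀ A → Entailed E m (dense A)) where

    laws-VIII : 2 ℕ.≤ m → All (Holds E m) VIII
    laws-VIII le =
      law le (dense A ∷ []) (h _ ∷ []) ((A ⟶ ∼ A) ⟶ ∼ A) ∷
      law le (dense (A ∧ B) ∷ []) (h _ ∷ []) (A ∧ B ⟶ A ∘ B) ∷
      -- This is the complement of ∼ A ∨ B; its density puts it below A ˘ ⨾ B ⁻, the complement of A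
      -- ⟶ B.
      law le (dense (A ˘ ∧ B ⁻) ∷ []) (h _ ∷ []) ((A ⟶ B) ⟶ ∼ A ∨ B) ∷ []

    laws-IX : 3 ℕ.≤ m → All (Holds E m) IX
    laws-IX le =
      law le (dense A ∷ []) (h _ ∷ []) ((A ⟶ (A ⟶ B)) ⟶ (A ⟶ B)) ∷
      law le (dense (A ∧ B) ∷ []) (h _ ∷ []) ((A ⟶ (B ⟶ C)) ⟶ (A ∧ B ⟶ C)) ∷ []

  module _ (h : ∀ A B → Entailed E m (commute A B)) where

    laws-X : 2 ℕ.≤ m → All (Holds E m) X
    laws-X le =
      law le (commute (A ⟶ B) A ∷ []) (h _ _ ∷ []) (A ⟶ ((A ⟶ B) ⟶ B)) ∷
      -- The double complement matches B ⟶ ∼ A, which unfolds to the complement of B ˘ ⨾ A ˘ ⁻ ⁻.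
      law le (commute (B ˘) (A ˘ ⁻ ⁻) ∷ []) (h _ _ ∷ []) ((A ⟶ ∼ B) ⟶ (B ⟶ ∼ A)) ∷ []

    laws-XI : 3 ℕ.≤ m → All (Holds E m) XI
    laws-XI le =
      instanceAt le (h _ _ ∷ []) zero permutation ∷
      law le (commute (B ⟶ C) (A ⟶ B) ∷ []) (h _ _ ∷ []) ((A ⟶ B) ⟶ ((B ⟶ C) ⟶ (A ⟶ C))) ∷ []

    laws-XII : (∀ A → Entailed E m (dense A)) → 3 ℕ.≤ m → All (Holds E m) XII
    laws-XII h′ le =
      -- Permutation turns the hypothesis into B ⟶ (A ⟶ C). With A ⟶ B this gives A ⟶ (A ⟶ C), which
      -- contracts to A ⟶ C.
      law le ((1′ , (A ⟶ (B ⟶ C)) ⟶ (B ⟶ (A ⟶ C))) ∷ (1′ , (A ⟶ (A ⟶ C)) ⟶ (A ⟶ C)) ∷ [])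
        (universal (λ x → instanceAt le (h _ _ ∷ []) x permutation) ∷
         universal (λ x → instanceAt le (h′ _ ∷ []) x contraction) ∷ [])
        ((A ⟶ (B ⟶ C)) ⟶ ((A ⟶ B) ⟶ (A ⟶ C))) ∷ []

  module _ (h : ∀ A → Entailed E m (A , A ˘)) (h′ : ∀ A → Entailed E m (A ˘ , A)) where

    laws-XIII : 1 ℕ.≤ m → All (Holds E m) XIII
    laws-XIII le = law le ((A , A ˘) ∷ []) (h _ ∷ []) (A ∧ ∼ A ⟶ B) ∷ []

    laws-XIV : 2 ℕ.≤ m → All (Holds E m) XIV
    laws-XIV le =
      -- A path along B and then A is reversed factor by factor into one along A and then B;
      -- symmetry of A ⨾ B turns the latter around.
      law le ((A , A ˘) ∷ (B , B ˘) ∷ ((A ⨾ B) ˘ , A ⨾ B) ∷ []) (h _ ∷ h _ ∷ h′ _ ∷ []) (A ∘ B ⟶ B ∘ A) ∷ []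

-- Transfer of the derivations to the two formalisms

module _ {Ψ : Pred Equation 0ℓ} {L : Pred Predicate 0ℓ} {m : ℕ} where

  -- The density equation has the sum A + A ⨾ A on its left, so A is first cut against this sum.
  dense-entailed : Density Unary.⊆ Ψ → ∀ A → Entailed (Entailment Ψ L) m (dense A)
  dense-entailed h A =
    cut (+ʳ (shared (here refl) (here refl))) (weaken (∈-∷⁺ʳ (here refl) λ ()) id (entail (forward (h (density A)))))

  commute-entailed : Commutativity Unary.⊆ Ψ → ∀ A B → Entailed (Entailment Ψ L) m (commute A B)
  commute-entailed h A B = entail (forward (h (commutativity A B)))

provableFrom : ∀ {Ψ n A} → Holds (Entailment Ψ ∅) n A → ProvableFrom Ψ (suc n) A
provableFrom = derive hypothesis λ ()

provable : ∀ {n A} → Holds (Entailment ∅ ∅) n A → Provable (suc n) A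
provable = derive (λ { (forward _ _ ()) ; (backward _ _ ()) }) λ ()

-- The sequents occurring in the given proof serve as the hypotheses of the derivation, whatever `Θ`
-- justified them; linearizing then adds only axioms and rule applications.
provableInference : ∀ {n} r → Holds (Entailment ∅ (_∈ premises r)) n (conclusion r) → ProvableInference (suc n) r
provableInference r d Θ π p os =
  let σ , e , _ , o = linearize (derive (λ { (forward _ _ ()) ; (backward _ _ ()) }) (hypothesis ∘′ All.lookup os) d) done
  in σ , e , o

provableInferences : ∀ ρ {n rs} → All (HoldsInference n) rs → All (ProvableInference (suc n)) (map (_[ ρ ]ᵢ) rs)
provableInferences ρ ds =
  All.map⁺ (All.map (λ {r} d → provableInference _ (Instances.inference ρ r ℕ.≤-refl d assumed)) ds)

closedUnder : ∀ ρ {Ψ k n rs} → n ℕ.≤ 2 ℕ.+ k → All (HoldsInference n) rs → All (ClosedUnder (Logic Ψ k)) (map (_[ ρ ]ᵢ) rs)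
closedUnder ρ n≤ ds =
  All.map⁺ (All.map (λ {r} d os → logic (Instances.inference ρ r n≤ d (λ p → assumed (All.lookup os p)))) ds)

theorem22 : (A B C D : Predicate) → let open Laws A B C D in
    All (Provable 1) I ×
    All (Provable 2) II ×
    All (Provable 3) III ×
    All (ProvableInference 1) IV ×
    All (ProvableInference 2) V ×
    All (ProvableInference 3) VI ×
    All (Provable 4) VII ×
    All (ProvableFrom Density 3) VIII ×
    All (ProvableFrom Density 4) IX ×
    All (ProvableFrom Commutativity 3) X ×
    All (ProvableFrom Commutativity 4) XI ×
    All (ProvableFrom (Density ∪ Commutativity) 4) XII ×
    All (ProvableFrom Symmetry 2) XIII ×
    All (ProvableFrom Symmetry 3) XIV ×
    (All CT₃ (I ++ II ++ III) ×
    All CT₄ (I ++ II ++ III ++ VII) ×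
    All TR (I ++ II ++ III ++ VII ++ X ++ XI ++ XII) ×
    All (ClosedUnder CT₃) (IV ++ V ++ VI) ×
    All (ClosedUnder CT₄) (IV ++ V ++ VI) ×
    All (ClosedUnder TR) (IV ++ V ++ VI))
theorem22 A B C D =
  All.map provable (laws z≤n laws₁) ,
  All.map provable (laws ℕ.≤-refl laws₂) ,
  All.map provable (laws ℕ.≤-refl laws₃) ,
  provableInferences ρ rules₁ ,
  provableInferences ρ rules₂ ,
  provableInferences ρ rules₃ ,
  All.map provable (laws ℕ.≤-refl laws₄) ,
  All.map provableFrom (laws-VIII A B C D (dense-entailed id) ℕ.≤-refl) ,
  All.map provableFrom (laws-IX A B C D (dense-entailed id) ℕ.≤-refl) ,
  All.map provableFrom (laws-X A B C D (commute-entailed id) ℕ.≤-refl) ,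
  All.map provableFrom (laws-XI A B C D (commute-entailed id) ℕ.≤-refl) ,
  All.map provableFrom (laws-XII A B C D (commute-entailed inj₂) (dense-entailed inj₁) ℕ.≤-refl) ,
  All.map provableFrom (laws-XIII A B C D symmetric symmetric′ ℕ.≤-refl) ,
  All.map provableFrom (laws-XIV A B C D symmetric symmetric′ ℕ.≤-refl) ,
  All.map logic (All.++⁺ (laws z≤n laws₁) (All.++⁺ (laws 1≤2 laws₂) (laws ℕ.≤-refl laws₃))) ,
  All.map logic (All.++⁺ (laws z≤n laws₁) (All.++⁺ (laws 1≤3 laws₂) (All.++⁺ (laws 2≤3 laws₃) (laws ℕ.≤-refl laws₄)))) ,
  All.map logic (All.++⁺ (laws z≤n laws₁) (All.++⁺ (laws 1≤3 laws₂) (All.++⁺ (laws 2≤3 laws₃) (All.++⁺ (laws ℕ.≤-refl laws₄)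
    (All.++⁺ (laws-X A B C D (commute-entailed inj₂) 2≤3) (All.++⁺ (laws-XI A B C D (commute-entailed inj₂) ℕ.≤-refl)
      (laws-XII A B C D (commute-entailed inj₂) (dense-entailed inj₁) ℕ.≤-refl))))))) ,
  rules 1≤2 ℕ.≤-refl ,
  rules 1≤3 2≤3 ,
  rules 1≤3 2≤3
  where
  ρ : ℕ → Predicate
  ρ = values A B C D
  laws : ∀ {E m n Ps} → n ℕ.≤ m → All (Holds (E′ {suc n} []) n) Ps → All (Holds E m) (map (_[ ρ ]ₚ) Ps)
  laws = Instances.laws ρ
  open Laws A B C D
  1≤2 : 1 ℕ.≤ 2
  1≤2 = s≤s z≤n
  1≤3 : 1 ℕ.≤ 3
  1≤3 = s≤s z≤n
  2≤3 : 2 ℕ.≤ 3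
  2≤3 = s≤s 1≤2
  symmetric : ∀ {n} P → Entailed (Entailment Symmetry ∅) n (P , P ˘)
  symmetric P = entail (forward (symmetry P))
  symmetric′ : ∀ {n} P → Entailed (Entailment Symmetry ∅) n (P ˘ , P)
  symmetric′ P = entail (backward (symmetry P))
  rules : ∀ {Ψ k} → 1 ℕ.≤ 2 ℕ.+ k → 2 ℕ.≤ 2 ℕ.+ k → All (ClosedUnder (Logic Ψ k)) (IV ++ V ++ VI)
  rules p q = All.++⁺ (closedUnder ρ z≤n rules₁) (All.++⁺ (closedUnder ρ p rules₂) (closedUnder ρ q rules₃))
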